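{- Let $p$ be a prime and let $k,n\geq 1$ and $s\geq 0$ be integers such that $k=\frac{p^{s+1}-1}{p-1}$. Let $R=\mathbb{Z}/p^k\mathbb{Z}$ and let $A(p^k,n)$ be the point–hyperplane incidence matrix over $R^n$ defined in the context. Then $$\operatorname{rank}_p\big(A(p^k,n)\big)\leq \frac{p^{kn}}{k^{n-1}}\left(1-\frac{1}{p}\right)^{ -n}.$$
   Context: $R=\mathbb{Z}/p^k\mathbb{Z}$. The projective space $\mathbb{P}(R)^{n-1}$ is the set of vectors $v\in R^n$ having at least one coordinate that is a unit of $R$, modulo the equivalence $v\sim u$ if $v=cu$ for a unit $c\in R$; fix one representative in $R^n$ for each class (e.g. the one whose first unit coordinate equals $1$), so $\mathbb{P}(R)^{n-1}\subset R^n$. For $u,v\in R^n$, $\langle u,v\rangle=\sum_{i=1}^n u_iv_i \bmod p^k$. For $b\in\mathbb{P}(R)^{n-1}$ and $\lambda\in R$, the hyperplane is $H_{b,\lambda}=\{v\in R^n:\langle v,b\rangle=\lambda\}$. The matrix $A(p^k,n)$ has rows indexed by $\mathbb{P}(R)^{n-1}\times R$ and columns indexed by $R^n$, with entry in position $((b,\lambda),v)$ equal to $1$ if $\langle b,v\rangle=\lambda$ and $0$ otherwise. For an integer matrix $M$, $\operatorname{rank}_p(M)$ denotes the rank of $M$ reduced modulo $p$, over the field $\mathbb{F}_p$. -}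

module Defs where

open import Data.Nat using (ℕ; zero; suc; _+_; _*_; _^_; _≟_; NonZero)
open import Data.Nat.Properties using (m^n≢0)
open import Data.Nat.DivMod using (_%_)
open import Data.Nat.Divisibility using (_∣_)
open import Data.Nat.Primality using (Prime; prime⇒nonZero)
open import Data.Fin using (Fin; toℕ) renaming (zero to fzero; suc to fsuc; _<_ to _<ᶠ_)
open import Data.Product using (Σ; _×_; _,_)
open import Relation.Binary.PropositionalEquality using (_≡_)
open import Relation.Nullary.Decidable using (yes; no)

∑ : (n : ℕ) → (Fin n → ℕ) → ℕ
∑ zero    f = 0
∑ (suc n) f = f fzero + ∑ n (λ i → f (fsuc i))

-- R = ℤ/mℤ is represented by Fin m (residues 0..m-1); R^n by Fin n → Fin m.
Rⁿ : ℕ → ℕ → Set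
Rⁿ m n = Fin n → Fin m

dotℕ : ∀ {m n} → Rⁿ m n → Rⁿ m n → ℕ
dotℕ {n = n} u v = ∑ n (λ i → toℕ (u i) * toℕ (v i))

-- Chosen representatives of P(ℤ/p^k)^{n-1}: vectors whose first unit
-- coordinate (first coordinate not divisible by p) equals 1.
IsProjRep : (p k n : ℕ) → Rⁿ (p ^ k) n → Set
IsProjRep p k n b =
  Σ (Fin n) λ i → ((j : Fin n) → j <ᶠ i → p ∣ toℕ (b j)) × (toℕ (b i) ≡ 1)

ProjSpace : (p k n : ℕ) → Set
ProjSpace p k n = Σ (Rⁿ (p ^ k) n) (IsProjRep p k n)

RowIdx : (p k n : ℕ) → Set
RowIdx p k n = ProjSpace p k n × Fin (p ^ k)

isIncident : (m : ℕ) → .{{_ : NonZero m}} → (n : ℕ) → Rⁿ m n → Fin m → Rⁿ m n → ℕ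
isIncident m n b λ₀ v with (dotℕ b v % m) ≟ toℕ λ₀
... | yes _ = 1
... | no  _ = 0

A : (p k n : ℕ) → Prime p → RowIdx p k n → Rⁿ (p ^ k) n → ℕ
A p k n pp ((b , _) , λ₀) v =
  isIncident (p ^ k) {{m^n≢0 p k {{prime⇒nonZero pp}}}} n b λ₀ v

-- Linear independence over 𝔽_p of the rows  rows 0, …, rows (r-1)  of an
-- integer matrix M (entries and coefficients reduced mod p).
LinIndepRowsₚ : {I J : Set} → (p : ℕ) → (I → J → ℕ) → (r : ℕ) → (Fin r → I) → Set
LinIndepRowsₚ {J = J} p M r rows =
  (c : Fin r → ℕ) →
  ((j : J) → p ∣ ∑ r (λ i → c i * M (rows i) j)) →
  (i : Fin r) → p ∣ c i

-- rank_p(M) is the maximal r such that M (mod p) has r linearly independent rows.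
-- "M has r 𝔽_p-linearly independent rows":
HasIndepRowsₚ : {I J : Set} → (p : ℕ) → (I → J → ℕ) → ℕ → Set
HasIndepRowsₚ {I} p M r = Σ (Fin r → I) (LinIndepRowsₚ p M r)

-- Put q = p ^ k, S = 𝔽_p[[w]] and z = 1 + w. Since z ^ q ≡ 1 modulo w ^ q, the
-- indicator of ⟨b , v⟩ = λ is, as a function of v, a combination of the
-- coefficients of degree below q of z ^ ⟨b , v⟩ = ∏ᵢ (z ^ bᵢ) ^ vᵢ. Newton
-- interpolation at the nodes z ^ c gives y ^ v = Σₜ κₜ(v) ∏_{c<t} (y - z ^ c) with
-- κₜ independent of b, and at y = z ^ b the product is divisible by w ^ oₜ, where
-- oₜ bounds from below the sum over c < t of the p-parts of b - c. Hence κₜ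
-- contributes at most q ∸ oₜ coefficients. Let m = k - s - 1. Because
-- k (p - 1) = p ^ (s + 1) - 1, a general coordinate multiplies the number of
-- coefficients by at most p ^ (m + 1), and one divisible by p by at most p ^ m.
-- The first unit coordinate of b equals 1 and costs nothing, so the rank is at most
-- q Σ_{i<n} p ^ (m i) p ^ ((m + 1)(n - 1 - i)), and
-- (k (p - 1)) ^ (n - 1) ≤ p ^ ((s + 1)(n - 1)) turns this into the claim.

module Submission where

open import Algebra.Bundles using (CommutativeMonoid; CommutativeRing)
open import Data.Nat using (ℕ; zero; suc; _≤_; _<_; _∸_; z≤n; s≤s; NonZero)
open import Data.Product using (∃; _×_; _,_; proj₁; proj₂)
open import Data.Sum using (inj₁; inj₂)
open import Function using (_∘_)
open import Relation.Binary.PropositionalEquality as ≡ using (_≡_)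
open import Relation.Nullary using (¬_; yes; no; contradiction)
import Data.Nat as ℕ
import Data.Nat.Properties as ℕₚ
open import Defs

-- Two demands shape the proof: one list of functions of `v` has to serve every `b`, and the counts
-- have to multiply over the coordinates. The first is met because the interpolation coefficients
-- depend on the nodes alone, and because `t` consecutive differences `b - c` contain the same
-- number of complete residue windows wherever they start; so the order can be bounded without
-- reference to `b`. For the second, a count at truncation `q` alone would not survive a product: a
-- factor `w ^ o` leaves the next coordinate only the degrees below `q - o`. Each coordinate is
-- therefore bounded by `C * x` at every truncation `x ≤ q`. Such a linear bound holds because the
-- indices of the first two windows can be paired so that the two orders of a pair add up to at
-- least `q`, while later indices have order at least `q`. The relation between `k` and `s` gives
-- `q = p ^ m * (p + (m + s) * (p - 1))`, and `p ^ m * (p + m * (p - 1))` is `p` times the total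
-- weight of a window of length `p ^ m`. The pairing then comes down to
-- `(2 s + 1) (p - 1) + s ≤ p ^ (s + 1)`.

module RangeFold {a ℓ} (M : CommutativeMonoid a ℓ) where

  open CommutativeMonoid M
  open import Algebra.Properties.CommutativeSemigroup commutativeSemigroup
    using (interchange)
  open import Relation.Binary.Reasoning.Setoid setoid

  -- Generic in the monoid, so that sums of naturals, sums in a ring and nodal products share their
  -- lemmas.
  fold : ℕ → (ℕ → Carrier) → Carrier
  fold zero    f = ε
  fold (suc n) f = fold n f ∙ f n

  fold-cong : ∀ n {f g} → (∀ i → i < n → f i ≈ g i) → fold n f ≈ fold n g
  fold-cong zero    eq = refl
  fold-cong (suc n) eq =
    ∙-cong (fold-cong n λ i i<n → eq i (ℕₚ.m<n⇒m<1+n i<n)) (eq n ℕₚ.≤-refl)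

  fold-ε : ∀ n {f} → (∀ i → f i ≈ ε) → fold n f ≈ ε
  fold-ε zero    eq = refl
  fold-ε (suc n) eq = trans (∙-cong (fold-ε n eq) (eq n)) (identityˡ ε)

  fold-∙ : ∀ n f g → fold n (λ i → f i ∙ g i) ≈ fold n f ∙ fold n g
  fold-∙ zero    f g = sym (identityˡ ε)
  fold-∙ (suc n) f g = trans (∙-congʳ (fold-∙ n f g)) (interchange _ _ _ _)

  fold-head : ∀ n f → fold (suc n) f ≈ f 0 ∙ fold n (f ∘ suc)
  fold-head zero    f = comm ε (f 0)
  fold-head (suc n) f = trans (∙-congʳ (fold-head n f)) (assoc _ _ _)

  fold-+ : ∀ m n f → fold (m ℕ.+ n) f ≈ fold m f ∙ fold n (λ i → f (m ℕ.+ i))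
  fold-+ m zero f = begin
    fold (m ℕ.+ 0) f ≡⟨ ≡.cong (λ k → fold k f) (ℕₚ.+-identityʳ m) ⟩
    fold m f         ≈⟨ identityʳ _ ⟨
    fold m f ∙ ε     ∎
  fold-+ m (suc n) f = begin
    fold (m ℕ.+ suc n) f
      ≡⟨ ≡.cong (λ k → fold k f) (ℕₚ.+-suc m n) ⟩
    fold (m ℕ.+ n) f ∙ f (m ℕ.+ n)
      ≈⟨ ∙-congʳ (fold-+ m n f) ⟩
    (fold m f ∙ fold n (λ i → f (m ℕ.+ i))) ∙ f (m ℕ.+ n)
      ≈⟨ assoc _ _ _ ⟩
    fold m f ∙ fold (suc n) (λ i → f (m ℕ.+ i)) ∎

  fold-* : ∀ m n f →
           fold (m ℕ.* n) f ≈ fold m (λ i → fold n (λ j → f (i ℕ.* n ℕ.+ j)))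
  fold-* zero    n f = refl
  fold-* (suc m) n f = begin
    fold (n ℕ.+ m ℕ.* n) f
      ≡⟨ ≡.cong (λ k → fold k f) (ℕₚ.+-comm n (m ℕ.* n)) ⟩
    fold (m ℕ.* n ℕ.+ n) f
      ≈⟨ fold-+ (m ℕ.* n) n f ⟩
    fold (m ℕ.* n) f ∙ fold n (λ j → f (m ℕ.* n ℕ.+ j))
      ≈⟨ ∙-congʳ (fold-* m n f) ⟩
    fold (suc m) (λ i → fold n (λ j → f (i ℕ.* n ℕ.+ j))) ∎

-- Finite sums of natural numbers

module _ where
  open RangeFold ℕₚ.+-0-commutativeMonoid public
    using () renaming
    ( fold to sum; fold-cong to sum-cong; fold-head to sum-head; fold-+ to sum-+
    ; fold-* to sum-*)

  sum-mono : ∀ n {f g : ℕ → ℕ} → (∀ i → i < n → f i ≤ g i) → sum n f ≤ sum n g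
  sum-mono zero    le = z≤n
  sum-mono (suc n) le =
    ℕₚ.+-mono-≤ (sum-mono n λ i i<n → le i (ℕₚ.m<n⇒m<1+n i<n)) (le n ℕₚ.≤-refl)

  sum-const : ∀ n x → sum n (λ _ → x) ≡ n ℕ.* x
  sum-const zero    x = ≡.refl
  sum-const (suc n) x = ≡.trans (≡.cong (ℕ._+ x) (sum-const n x)) (ℕₚ.+-comm _ x)

  sum-monoˡ : ∀ {m n} f → m ≤ n → sum m f ≤ sum n f
  sum-monoˡ {m} {n} f m≤n = begin
    sum m f             ≤⟨ ℕₚ.m≤m+n (sum m f) _ ⟩
    sum m f ℕ.+ _       ≡⟨ sum-+ m (n ∸ m) f ⟨
    sum (m ℕ.+ (n ∸ m)) f ≡⟨ ≡.cong (λ k → sum k f) (ℕₚ.m+[n∸m]≡n m≤n) ⟩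
    sum n f             ∎
    where open ℕₚ.≤-Reasoning

  -- Moving the start by one trades the summand `f x` at the front for the equal summand `f (x + P)`
  -- at the back.
  sum-shift : ∀ P f → (∀ x → f (x ℕ.+ P) ≡ f x) →
              ∀ x → sum P (λ c → f (x ℕ.+ c)) ≡ sum P f
  sum-shift P f per zero    = ≡.refl
  sum-shift P f per (suc x) = ≡.trans
    (ℕₚ.+-cancelˡ-≡ (f x) _ _ (begin
      f x ℕ.+ sum P (λ c → f (suc x ℕ.+ c))
        ≡⟨ ≡.cong₂ ℕ._+_ (≡.cong f (ℕₚ.+-identityʳ x))
             (sum-cong P λ c _ → ≡.cong f (ℕₚ.+-suc x c)) ⟨
      f (x ℕ.+ 0) ℕ.+ sum P (λ c → f (x ℕ.+ suc c))
        ≡⟨ sum-head P (λ c → f (x ℕ.+ c)) ⟨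
      sum P (λ c → f (x ℕ.+ c)) ℕ.+ f (x ℕ.+ P)
        ≡⟨ ≡.cong (sum P (λ c → f (x ℕ.+ c)) ℕ.+_) (per x) ⟩
      sum P (λ c → f (x ℕ.+ c)) ℕ.+ f x
        ≡⟨ ℕₚ.+-comm _ (f x) ⟩
      f x ℕ.+ sum P (λ c → f (x ℕ.+ c)) ∎))
    (sum-shift P f per x)
    where open ≡.≡-Reasoning

  -- The second sum is read backwards, so that i is paired with n ∸ 1 ∸ i.
  sum-pair-≤ : ∀ n f g x → (∀ i j → i ℕ.+ suc j ≡ n → f i ℕ.+ g j ≤ x) →
               sum n f ℕ.+ sum n g ≤ n ℕ.* x
  sum-pair-≤ zero    f g x le = z≤n
  sum-pair-≤ (suc n) f g x le = begin
    (sum n f ℕ.+ f n) ℕ.+ sum (suc n) g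
      ≡⟨ ≡.cong ((sum n f ℕ.+ f n) ℕ.+_) (sum-head n g) ⟩
    (sum n f ℕ.+ f n) ℕ.+ (g 0 ℕ.+ sum n (g ∘ suc))
      ≡⟨ ℕₚ.+-assoc (sum n f) _ _ ⟩
    sum n f ℕ.+ (f n ℕ.+ (g 0 ℕ.+ sum n (g ∘ suc)))
      ≡⟨ ≡.cong (sum n f ℕ.+_) (ℕₚ.+-assoc (f n) _ _) ⟨
    sum n f ℕ.+ ((f n ℕ.+ g 0) ℕ.+ sum n (g ∘ suc))
      ≡⟨ ≡.cong (sum n f ℕ.+_) (ℕₚ.+-comm (f n ℕ.+ g 0) _) ⟩
    sum n f ℕ.+ (sum n (g ∘ suc) ℕ.+ (f n ℕ.+ g 0))
      ≡⟨ ℕₚ.+-assoc (sum n f) _ _ ⟨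
    (sum n f ℕ.+ sum n (g ∘ suc)) ℕ.+ (f n ℕ.+ g 0)
      ≤⟨ ℕₚ.+-mono-≤
           (sum-pair-≤ n f (g ∘ suc) x λ i j eq →
             le i (suc j) (≡.trans (ℕₚ.+-suc i (suc j)) (≡.cong suc eq)))
           (le n 0 (≡.trans (ℕₚ.+-suc n 0) (≡.cong suc (ℕₚ.+-identityʳ n)))) ⟩
    n ℕ.* x ℕ.+ x
      ≡⟨ ℕₚ.+-comm (n ℕ.* x) x ⟩
    suc n ℕ.* x ∎
    where open ℕₚ.≤-Reasoning

-- Truncated p-parts summed over consecutive integers

module WindowWeights (p : ℕ) .{{_ : NonZero p}} where

  open import Data.Nat using (_+_; _*_; _^_; _/_; _%_)
  open import Data.Nat.Divisibility
    using (_∣_; _∣?_; ∣m+n∣m⇒∣n; ∣m∣n⇒∣m+n; ∣-trans; ∣-refl; n∣m*n;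
           _∣0; 1∣_; ∣⇒≤)
  open import Data.Nat.DivMod
    using (m≡m%n+[m/n]*n; m<n⇒m/n≡0; m*n/n≡m; +-distrib-/-∣ˡ;
           [m+kn]%n≡m%n; m<n⇒m%n≡m)

  p^j≢0 : ∀ j → NonZero (p ^ j)
  p^j≢0 j = ℕₚ.m^n≢0 p j

  -- p ^ min(j , v_p x)
  ω : ℕ → ℕ → ℕ
  ω zero    x = 1
  ω (suc j) x with p ^ suc j ∣? x
  ... | yes _ = p ^ suc j
  ... | no  _ = ω j x

  ω-∣ : ∀ j {x} → p ^ j ∣ x → ω j x ≡ p ^ j
  ω-∣ zero    p^j∣x = ≡.refl
  ω-∣ (suc j) {x} p^j∣x with p ^ suc j ∣? x
  ... | yes _  = ≡.refl
  ... | no  ∤x = contradiction p^j∣x ∤x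

  ω-∤ : ∀ j {x} → ¬ p ^ suc j ∣ x → ω (suc j) x ≡ ω j x
  ω-∤ j {x} ∤x with p ^ suc j ∣? x
  ... | yes ∣x = contradiction ∣x ∤x
  ... | no  _  = ≡.refl

  p^j∣p^[1+j] : ∀ j → p ^ j ∣ p ^ suc j
  p^j∣p^[1+j] j = n∣m*n p

  p^j≤p^[1+j] : ∀ j → p ^ j ≤ p ^ suc j
  p^j≤p^[1+j] j = ∣⇒≤ {{p^j≢0 (suc j)}} (p^j∣p^[1+j] j)

  -- The exponent `i` is exposed because Frobenius yields orders that are powers of `p`.
  ω-power : ∀ j x → ∃ λ i → i ≤ j × ω j x ≡ p ^ i × p ^ i ∣ x
  ω-power zero    x = 0 , z≤n , ≡.refl , 1∣ x
  ω-power (suc j) x with p ^ suc j ∣? x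
  ... | yes ∣x = suc j , ℕₚ.≤-refl , ≡.refl , ∣x
  ... | no  _  with ω-power j x
  ...   | i , i≤j , eq , ∣x = i , ℕₚ.m≤n⇒m≤1+n i≤j , eq , ∣x

  ω≤p^j : ∀ j x → ω j x ≤ p ^ j
  ω≤p^j zero    x = ℕₚ.≤-refl
  ω≤p^j (suc j) x with p ^ suc j ∣? x
  ... | yes _ = ℕₚ.≤-refl
  ... | no  _ = ℕₚ.≤-trans (ω≤p^j j x) (p^j≤p^[1+j] j)

  ω-suc-≥ : ∀ j x → ω j x ≤ ω (suc j) x
  ω-suc-≥ j x with p ^ suc j ∣? x
  ... | yes _ = ℕₚ.≤-trans (ω≤p^j j x) (p^j≤p^[1+j] j)
  ... | no  _ = ℕₚ.≤-refl

  ω-periodic : ∀ j d x → p ^ j ∣ d → ω j (d + x) ≡ ω j x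
  ω-periodic zero    d x ∣d = ≡.refl
  ω-periodic (suc j) d x ∣d with p ^ suc j ∣? x
  ... | yes ∣x = ω-∣ (suc j) (∣m∣n⇒∣m+n ∣d ∣x)
  ... | no  ∤x = ≡.trans (ω-∤ j λ ∣d+x → ∤x (∣m+n∣m⇒∣n ∣d+x ∣d))
                         (ω-periodic j d x (∣-trans (p^j∣p^[1+j] j) ∣d))

  O : ℕ → ℕ
  O j = sum (p ^ j) (ω j)

  O-window : ∀ j x → sum (p ^ j) (λ c → ω j (x + c)) ≡ O j
  O-window j = sum-shift (p ^ j) (ω j) λ x →
    ≡.trans (≡.cong (ω j) (ℕₚ.+-comm x _)) (ω-periodic j (p ^ j) x ∣-refl)

  sum-ω-windows : ∀ j a x → sum (a * p ^ j) (λ c → ω j (x + c)) ≡ a * O j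
  sum-ω-windows j a x = begin
    sum (a * p ^ j) (λ c → ω j (x + c))
      ≡⟨ sum-* a (p ^ j) _ ⟩
    sum a (λ i → sum (p ^ j) (λ c → ω j (x + (i * p ^ j + c))))
      ≡⟨ sum-cong a (λ i _ → ≡.trans
           (sum-cong (p ^ j) λ c _ → ≡.cong (ω j) (≡.sym (ℕₚ.+-assoc x (i * p ^ j) c)))
           (O-window j (x + i * p ^ j))) ⟩
    sum a (λ _ → O j)
      ≡⟨ sum-const a (O j) ⟩
    a * O j ∎
    where open ≡.≡-Reasoning

  -- Passing from ω j to ω (suc j) on a window of length p ^ suc j only changes
  -- the weight of the one multiple of p ^ suc j.
  O-suc : ∀ j → O (suc j) + p ^ j ≡ p * O j + p ^ suc j
  O-suc j = begin
    O (suc j) + p ^ j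
      ≡⟨ ≡.cong (λ k → sum k (ω (suc j)) + p ^ j) 1+n≡ ⟨
    sum (suc n) (ω (suc j)) + p ^ j
      ≡⟨ ≡.cong (_+ p ^ j) (sum-head n (ω (suc j))) ⟩
    (ω (suc j) 0 + sum n (ω (suc j) ∘ suc)) + p ^ j
      ≡⟨ ≡.cong₂ (λ u v → (u + v) + p ^ j) (ω-∣ (suc j) (_ ∣0))
           (sum-cong n λ i i<n → ω-∤ j λ ∣i →
             ℕₚ.<⇒≱ (s≤s i<n)
               (ℕₚ.≤-trans (ℕₚ.≤-reflexive 1+n≡) (∣⇒≤ {n = suc i} ∣i))) ⟩
    (p ^ suc j + sum n (ω j ∘ suc)) + p ^ j
      ≡⟨ ℕₚ.+-assoc (p ^ suc j) _ _ ⟩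
    p ^ suc j + (sum n (ω j ∘ suc) + p ^ j)
      ≡⟨ ≡.cong (p ^ suc j +_) (≡.trans (ℕₚ.+-comm _ (p ^ j))
           (≡.trans (≡.cong (_+ sum n (ω j ∘ suc)) (≡.sym (ω-∣ j (_ ∣0))))
                    (≡.sym (sum-head n (ω j))))) ⟩
    p ^ suc j + sum (suc n) (ω j)
      ≡⟨ ≡.cong (λ k → p ^ suc j + sum k (ω j)) 1+n≡ ⟩
    p ^ suc j + sum (p ^ suc j) (ω j)
      ≡⟨ ≡.cong (p ^ suc j +_) (sum-ω-windows j p 0) ⟩
    p ^ suc j + p * O j
      ≡⟨ ℕₚ.+-comm (p ^ suc j) _ ⟩
    p * O j + p ^ suc j ∎
    where
    open ≡.≡-Reasoning
    n = ℕ.pred (p ^ suc j)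
    1+n≡ : suc n ≡ p ^ suc j
    1+n≡ = ℕₚ.suc-pred (p ^ suc j) {{p^j≢0 (suc j)}}

  module _ (j : ℕ) where

    private
      P′ P U V : ℕ
      P′ = p ^ suc j
      P  = p ^ j
      U  = O (suc j)
      V  = O j

      instance
        P′≢0 : NonZero P′
        P′≢0 = p^j≢0 (suc j)
        P≢0 : NonZero P
        P≢0 = p^j≢0 j

    -- A lower bound for the sum of `t` consecutive weights that does not mention the start. Each
    -- full window of length `p ^ suc j` carries exactly `U`, each further full window of length
    -- `p ^ j` carries at least `V`, and the remainder is dropped.
    windowWeight : ℕ → ℕ
    windowWeight t = (t / P′) * U + ((t % P′) / P) * V

    windowWeight-≤ : ∀ x t → windowWeight t ≤ sum t (λ c → ω (suc j) (x + c))
    windowWeight-≤ x t = begin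
      a * U + b * V
        ≡⟨ ≡.cong₂ _+_ (sum-ω-windows (suc j) a x) (sum-ω-windows j b (x + a * P′)) ⟨
      sum (a * P′) f + sum (b * P) (λ c → ω j (x + a * P′ + c))
        ≤⟨ ℕₚ.+-monoʳ-≤ _ (sum-monoˡ _ bP≤r) ⟩
      sum (a * P′) f + sum r (λ c → ω j (x + a * P′ + c))
        ≤⟨ ℕₚ.+-monoʳ-≤ _ (sum-mono r λ c _ → ω-suc-≥ j _) ⟩
      sum (a * P′) f + sum r (λ c → ω (suc j) (x + a * P′ + c))
        ≡⟨ ≡.cong (sum (a * P′) f +_)
             (sum-cong r λ c _ → ≡.cong (ω (suc j)) (ℕₚ.+-assoc x _ c)) ⟩
      sum (a * P′) f + sum r (λ c → f (a * P′ + c))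
        ≡⟨ sum-+ (a * P′) r f ⟨
      sum (a * P′ + r) f
        ≡⟨ ≡.cong (λ k → sum k f) (≡.trans (ℕₚ.+-comm (a * P′) r)
             (≡.sym (m≡m%n+[m/n]*n t P′))) ⟩
      sum t f ∎
      where
      open ℕₚ.≤-Reasoning
      a r b : ℕ
      a = t / P′
      r = t % P′
      b = r / P
      f : ℕ → ℕ
      f c = ω (suc j) (x + c)
      bP≤r : b * P ≤ r
      bP≤r = ℕₚ.≤-trans (ℕₚ.m≤n+m _ (r % P)) (ℕₚ.≤-reflexive (≡.sym (m≡m%n+[m/n]*n r P)))

    private
      [aP+i]/P≡a : ∀ {P} .{{_ : NonZero P}} a i → i < P → (a * P + i) / P ≡ a
      [aP+i]/P≡a {P} a i i<P = begin
        (a * P + i) / P   ≡⟨ +-distrib-/-∣ˡ i (n∣m*n a) ⟩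
        a * P / P + i / P ≡⟨ ≡.cong₂ _+_ (m*n/n≡m a P) (m<n⇒m/n≡0 i<P) ⟩
        a + 0             ≡⟨ ℕₚ.+-identityʳ a ⟩
        a                 ∎
        where open ≡.≡-Reasoning

      [aP+i]%P≡i : ∀ {P} .{{_ : NonZero P}} a i → i < P → (a * P + i) % P ≡ i
      [aP+i]%P≡i {P} a i i<P = ≡.trans (≡.cong (_% P) (ℕₚ.+-comm (a * P) i))
        (≡.trans ([m+kn]%n≡m%n i a P) (m<n⇒m%n≡m i<P))

    windowWeight-digits : ∀ a b i → b < p → i < P →
                          windowWeight (a * P′ + (b * P + i)) ≡ a * U + b * V
    windowWeight-digits a b i b<p i<P = ≡.cong₂ (λ u v → u * U + v * V)
      ([aP+i]/P≡a a _ bP+i<P′)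
      (≡.trans (≡.cong (_/ P) ([aP+i]%P≡i a _ bP+i<P′)) ([aP+i]/P≡a b i i<P))
      where
      open ℕₚ.≤-Reasoning
      bP+i<P′ : b * P + i < P′
      bP+i<P′ = begin-strict
        b * P + i <⟨ ℕₚ.+-monoʳ-< (b * P) i<P ⟩
        b * P + P ≡⟨ ℕₚ.+-comm (b * P) P ⟩
        suc b * P ≤⟨ ℕₚ.*-monoˡ-≤ P b<p ⟩
        P′        ∎

    -- For t < 2 p ^ suc j the weights are b V and U + b V with b < p, each
    -- p ^ j times; x ∸ b V and x ∸ (U + (p ∸ 1 ∸ b) V) add up to at most x.
    cost-≤ : ∀ c N x → x ≤ c * U + (p ∸ 1) * (c * V) → x ≤ 2 * (c * U) →
             sum ((2 + N) * P′) (λ t → x ∸ c * windowWeight t) ≤ P′ * x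
    cost-≤ c N x x≤U+V x≤2U = begin
      sum ((2 + N) * P′) (λ t → x ∸ c * windowWeight t)
        ≡⟨ sum-* (2 + N) P′ _ ⟩
      sum (2 + N) (λ a → sum P′ (λ i → x ∸ c * windowWeight (a * P′ + i)))
        ≡⟨ sum-cong (2 + N) (λ a _ → block a) ⟩
      sum (2 + N) (λ a → P * sum p (g a))
        ≡⟨ sum-+ 2 N _ ⟩
      (P * sum p (g 0) + P * sum p (g 1)) + sum N (λ a → P * sum p (g (2 + a)))
        ≡⟨ ≡.cong₂ _+_ (≡.sym (ℕₚ.*-distribˡ-+ P _ _)) tail≡0 ⟩
      P * (sum p (g 0) + sum p (g 1)) + 0
        ≡⟨ ℕₚ.+-identityʳ _ ⟩
      P * (sum p (g 0) + sum p (g 1))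
        ≤⟨ ℕₚ.*-monoʳ-≤ P (sum-pair-≤ p (g 0) (g 1) x pair) ⟩
      P * (p * x)
        ≡⟨ ≡.trans (≡.sym (ℕₚ.*-assoc P p x)) (≡.cong (_* x) (ℕₚ.*-comm P p)) ⟩
      P′ * x ∎
      where
      open ℕₚ.≤-Reasoning
      g : ℕ → ℕ → ℕ
      g a b = x ∸ c * (a * U + b * V)

      block : ∀ a → sum P′ (λ i → x ∸ c * windowWeight (a * P′ + i)) ≡ P * sum p (g a)
      block a = begin-equality
        sum P′ (λ i → x ∸ c * windowWeight (a * P′ + i))
          ≡⟨ sum-* p P _ ⟩
        sum p (λ b → sum P (λ i → x ∸ c * windowWeight (a * P′ + (b * P + i))))
          ≡⟨ sum-cong p (λ b b<p → ≡.trans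
               (sum-cong P λ i i<P →
                 ≡.cong (λ u → x ∸ c * u) (windowWeight-digits a b i b<p i<P))
               (sum-const P (g a b))) ⟩
        sum p (λ b → P * g a b)
          ≡⟨ *-sum p (g a) ⟨
        P * sum p (g a) ∎
        where
        *-sum : ∀ n f → P * sum n f ≡ sum n (λ b → P * f b)
        *-sum zero    f = ℕₚ.*-zeroʳ P
        *-sum (suc n) f = ≡.trans (ℕₚ.*-distribˡ-+ P _ _) (≡.cong (_+ P * f n) (*-sum n f))

      2U≤ : ∀ a b → 2 * (c * U) ≤ c * ((2 + a) * U + b * V)
      2U≤ a b = begin
        2 * (c * U)               ≡⟨ ℕₚ.*-assoc 2 c U ⟨
        2 * c * U                 ≡⟨ ≡.cong (_* U) (ℕₚ.*-comm 2 c) ⟩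
        c * 2 * U                 ≡⟨ ℕₚ.*-assoc c 2 U ⟩
        c * (2 * U)               ≤⟨ ℕₚ.*-monoʳ-≤ c (ℕₚ.*-monoˡ-≤ U (ℕₚ.m≤m+n 2 a)) ⟩
        c * ((2 + a) * U)         ≤⟨ ℕₚ.*-monoʳ-≤ c (ℕₚ.m≤m+n _ (b * V)) ⟩
        c * ((2 + a) * U + b * V) ∎

      tail≡0 : sum N (λ a → P * sum p (g (2 + a))) ≡ 0
      tail≡0 = ≡.trans
        (sum-cong N λ a _ → ≡.trans
          (≡.cong (P *_) (≡.trans
            (sum-cong p λ b _ → ℕₚ.m≤n⇒m∸n≡0 (ℕₚ.≤-trans x≤2U (2U≤ a b)))
            (≡.trans (sum-const p 0) (ℕₚ.*-zeroʳ p))))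
          (ℕₚ.*-zeroʳ P))
        (≡.trans (sum-const N 0) (ℕₚ.*-zeroʳ N))

      m+n≡pair : ∀ i k → i + suc k ≡ p → i + k ≡ p ∸ 1
      m+n≡pair i k eq = ≡.cong ℕ.pred (≡.trans (≡.sym (ℕₚ.+-suc i k)) eq)

      weights : ∀ i k → i + suc k ≡ p →
                x ≤ c * (0 * U + i * V) + c * (1 * U + k * V)
      weights i k eq = begin
        x                                 ≤⟨ x≤U+V ⟩
        c * U + (p ∸ 1) * (c * V)         ≡⟨ ≡.cong (λ d → c * U + d * (c * V)) (m+n≡pair i k eq) ⟨
        c * U + (i + k) * (c * V)         ≡⟨ identity c U V i k ⟩
        c * (0 * U + i * V) + c * (1 * U + k * V) ∎
        where
        open import Data.Nat.Solver using (module +-*-Solver)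
        open +-*-Solver
        identity : ∀ c U V i k → c * U + (i + k) * (c * V) ≡
                                 c * (0 * U + i * V) + c * (1 * U + k * V)
        identity = solve 5 (λ c U V i k →
          c :* U :+ (i :+ k) :* (c :* V) :=
          c :* (con 0 :* U :+ i :* V) :+ c :* (con 1 :* U :+ k :* V)) ≡.refl

      ∸+∸≤ : ∀ x a b → x ≤ a + b → (x ∸ a) + (x ∸ b) ≤ x
      ∸+∸≤ x a b x≤a+b with ℕₚ.≤-total x b
      ... | inj₁ x≤b = begin
        (x ∸ a) + (x ∸ b) ≡⟨ ≡.cong (x ∸ a +_) (ℕₚ.m≤n⇒m∸n≡0 x≤b) ⟩
        (x ∸ a) + 0       ≡⟨ ℕₚ.+-identityʳ _ ⟩
        x ∸ a             ≤⟨ ℕₚ.m∸n≤m x a ⟩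
        x                 ∎
      ... | inj₂ b≤x = begin
        (x ∸ a) + (x ∸ b) ≤⟨ ℕₚ.+-monoˡ-≤ (x ∸ b) (ℕₚ.m≤n+o⇒m∸n≤o x a x≤a+b) ⟩
        b + (x ∸ b)       ≡⟨ ℕₚ.m+[n∸m]≡n b≤x ⟩
        x                 ∎

      pair : ∀ i k → i + suc k ≡ p → g 0 i + g 1 k ≤ x
      pair i k eq = ∸+∸≤ x (c * (0 * U + i * V)) (c * (1 * U + k * V)) (weights i k eq)

-- The geometric sum of `D ^ i * C ^ (n - 1 - i)` over `i < n`, where `i` is the position of the
-- first unit coordinate.
chartBound : ℕ → ℕ → ℕ → ℕ
chartBound C D zero    = 0
chartBound C D (suc n) = C ℕ.^ n ℕ.+ D ℕ.* chartBound C D n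

-- Spans of functions weighted by orders in `w`

module WeightedSpan {c ℓ} (R : CommutativeRing c ℓ) (w : CommutativeRing.Carrier R) (J : Set) where

  open CommutativeRing R
  open import Algebra.Properties.Semiring.Exp semiring using (_^_; ^-homo-*)
  open import Algebra.Properties.Semiring.Divisibility semiring using (_∣_)
  open import Algebra.Definitions.RawMagma *-rawMagma using (_,_)
  open import Algebra.Properties.CommutativeSemigroup *-commutativeSemigroup
    using (interchange)
  open import Data.Fin using (Fin) renaming (zero to fzero; suc to fsuc; _<_ to _<ᶠ_)
  open import Data.List using (List; []; _∷_; _++_; map; applyUpTo)
  open import Level using (_⊔_)
  import Relation.Binary.Reasoning.Setoid as SetoidReasoning
  open RangeFold +-commutativeMonoid using (fold; fold-head)

  private module ≈-Reasoning = SetoidReasoning setoid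

  Term : Set c
  Term = ℕ × (J → Carrier)

  -- A term (o , K) stands for the multiples of w ^ o by scalars, times K.
  data Span : List Term → (J → Carrier) → Set (c ⊔ ℓ) where
    nil  : ∀ {g} → (∀ j → g j ≈ 0#) → Span [] g
    cons : ∀ {o K L g h} e → (∀ j → g j ≈ w ^ o * e * K j + h j) → Span L h →
             Span ((o , K) ∷ L) g

  -- The number of coefficients of degree below x that the terms leave free.
  cost : List Term → ℕ → ℕ
  cost []            x = 0
  cost ((o , _) ∷ L) x = (x ∸ o) ℕ.+ cost L x

  Span-cong : ∀ {L g h} → (∀ j → g j ≈ h j) → Span L g → Span L h
  Span-cong eq (nil g≈0)      = nil λ j → trans (sym (eq j)) (g≈0 j)
  Span-cong eq (cons e g≈ s) = cons e (λ j → trans (sym (eq j)) (g≈ j)) s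

  Span-0 : ∀ L → Span L (λ _ → 0#)
  Span-0 []      = nil λ _ → refl
  Span-0 (_ ∷ L) = cons 0# (λ j → sym (trans
    (+-identityʳ _) (trans (*-congʳ (zeroʳ _)) (zeroˡ _)))) (Span-0 L)

  Span-++ : ∀ {L M g h} → Span L g → Span M h → Span (L ++ M) (λ j → g j + h j)
  Span-++ (nil g≈0)      t =
    Span-cong (λ j → sym (trans (+-congʳ (g≈0 j)) (+-identityˡ _))) t
  Span-++ (cons e g≈ s) t =
    cons e (λ j → trans (+-congʳ (g≈ j)) (+-assoc _ _ _)) (Span-++ s t)

  Span-++ˡ : ∀ {L g} M → Span L g → Span (L ++ M) g
  Span-++ˡ M s = Span-cong (λ j → +-identityʳ _) (Span-++ s (Span-0 M))

  Span-++ʳ : ∀ L {M g} → Span M g → Span (L ++ M) g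
  Span-++ʳ L s = Span-cong (λ j → +-identityˡ _) (Span-++ (Span-0 L) s)

  scale : Term → Term → Term
  scale (o , K) (o′ , K′) = o ℕ.+ o′ , λ j → K j * K′ j

  Span-scale : ∀ {o K L h} e → Span L h →
               Span (map (scale (o , K)) L) (λ j → w ^ o * e * K j * h j)
  Span-scale e (nil h≈0) = nil λ j → trans (*-congˡ (h≈0 j)) (zeroʳ _)
  Span-scale {o} {K} e (cons {o′} {K′} {h = h} e′ g≈ s) =
    cons (e * e′) (λ j → trans (*-congˡ (g≈ j)) (trans (distribˡ _ _ _) (+-congʳ (begin
      w ^ o * e * K j * (w ^ o′ * e′ * K′ j)
        ≈⟨ interchange _ _ _ _ ⟩
      w ^ o * e * (w ^ o′ * e′) * (K j * K′ j)
        ≈⟨ *-congʳ (interchange _ _ _ _) ⟩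
      w ^ o * w ^ o′ * (e * e′) * (K j * K′ j)
        ≈⟨ *-congʳ (*-congʳ (^-homo-* w o o′)) ⟨
      w ^ (o ℕ.+ o′) * (e * e′) * (K j * K′ j) ∎)))) (Span-scale e s)
    where open ≈-Reasoning

  infixr 7 _⊗_

  _⊗_ : List Term → List Term → List Term
  []      ⊗ M = []
  (t ∷ L) ⊗ M = map (scale t) M ++ L ⊗ M

  Span-⊗ : ∀ {L M g h} → Span L g → Span M h → Span (L ⊗ M) (λ j → g j * h j)
  Span-⊗ (nil g≈0) t = nil λ j → trans (*-congʳ (g≈0 j)) (zeroˡ _)
  Span-⊗ (cons e g≈ s) t =
    Span-cong (λ j → sym (trans (*-congʳ (g≈ j)) (distribʳ _ _ _)))
      (Span-++ (Span-scale e t) (Span-⊗ s t))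

  -- The quotient of `e t` by its power of `w` becomes the free scalar. For a Newton expansion `e t`
  -- is the nodal product, the only factor that depends on the row.
  Span-applyUpTo : ∀ n {o : ℕ → ℕ} {K : ℕ → J → Carrier} (e : ℕ → Carrier) →
                   (∀ t → w ^ o t ∣ e t) →
                   Span (applyUpTo (λ t → o t , K t) n)
                        (λ j → fold n (λ t → e t * K t j))
  Span-applyUpTo zero    e w∣e = nil λ _ → refl
  Span-applyUpTo (suc n) {K = K} e w∣e with d , d*w≈e ← w∣e 0 =
    cons d (λ j → trans (fold-head n _)
           (+-congʳ (*-congʳ (trans (sym d*w≈e) (*-comm d _)))))
      (Span-applyUpTo n (e ∘ suc) (w∣e ∘ suc))

  cost-++ : ∀ L M x → cost (L ++ M) x ≡ cost L x ℕ.+ cost M x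
  cost-++ []            M x = ≡.refl
  cost-++ ((o , _) ∷ L) M x =
    ≡.trans (≡.cong ((x ∸ o) ℕ.+_) (cost-++ L M x)) (≡.sym (ℕₚ.+-assoc (x ∸ o) _ _))

  cost-scale : ∀ o K M x → cost (map (scale (o , K)) M) x ≡ cost M (x ∸ o)
  cost-scale o K []             x = ≡.refl
  cost-scale o K ((o′ , _) ∷ M) x =
    ≡.cong₂ ℕ._+_ (≡.sym (ℕₚ.∸-+-assoc x o o′)) (cost-scale o K M x)

  cost-applyUpTo : ∀ n (o : ℕ → ℕ) (K : ℕ → J → Carrier) x →
                   cost (applyUpTo (λ t → o t , K t) n) x ≡ sum n (λ t → x ∸ o t)
  cost-applyUpTo zero    o K x = ≡.refl
  cost-applyUpTo (suc n) o K x = ≡.trans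
    (≡.cong ((x ∸ o 0) ℕ.+_) (cost-applyUpTo n (o ∘ suc) (K ∘ suc) x))
    (≡.sym (sum-head n _))

  -- The bound is linear and holds at every truncation up to `q`, which is what makes it
  -- multiplicative under `_⊗_`.
  record Cost≤ (q C : ℕ) (L : List Term) : Set where
    constructor cost≤
    field bound : ∀ {x} → x ≤ q → cost L x ≤ C ℕ.* x

  open Cost≤

  Cost≤-++ : ∀ {q C D} L M → Cost≤ q C L → Cost≤ q D M → Cost≤ q (C ℕ.+ D) (L ++ M)
  Cost≤-++ {q} {C} {D} L M l m .bound {x} x≤q = ℕₚ.≤-trans
    (ℕₚ.≤-reflexive (cost-++ L M x))
    (ℕₚ.≤-trans (ℕₚ.+-mono-≤ (l .bound x≤q) (m .bound x≤q))
      (ℕₚ.≤-reflexive (≡.sym (ℕₚ.*-distribʳ-+ x C D))))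

  -- A term of order `o` in `L` leaves `M` the degrees below `x ∸ o`. This is again at most `q`, so
  -- the bound for `M` applies term by term.
  cost-⊗ : ∀ {q D} L M → Cost≤ q D M → ∀ {x} → x ≤ q → cost (L ⊗ M) x ≤ D ℕ.* cost L x
  cost-⊗ []            M m x≤q = z≤n
  cost-⊗ {D = D} ((o , K) ∷ L) M m {x} x≤q = begin
    cost (map (scale (o , K)) M ++ L ⊗ M) x
      ≡⟨ cost-++ (map (scale (o , K)) M) (L ⊗ M) x ⟩
    cost (map (scale (o , K)) M) x ℕ.+ cost (L ⊗ M) x
      ≡⟨ ≡.cong (ℕ._+ cost (L ⊗ M) x) (cost-scale o K M x) ⟩
    cost M (x ∸ o) ℕ.+ cost (L ⊗ M) x
      ≤⟨ ℕₚ.+-mono-≤ (m .bound (ℕₚ.≤-trans (ℕₚ.m∸n≤m x o) x≤q)) (cost-⊗ L M m x≤q) ⟩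
    D ℕ.* (x ∸ o) ℕ.+ D ℕ.* cost L x
      ≡⟨ ℕₚ.*-distribˡ-+ D (x ∸ o) (cost L x) ⟨
    D ℕ.* (x ∸ o ℕ.+ cost L x) ∎
    where open ℕₚ.≤-Reasoning

  Cost≤-⊗ : ∀ {q C D} L M → Cost≤ q C L → Cost≤ q D M → Cost≤ q (C ℕ.* D) (L ⊗ M)
  Cost≤-⊗ {q} {C} {D} L M l m .bound {x} x≤q = begin
    cost (L ⊗ M) x   ≤⟨ cost-⊗ L M m x≤q ⟩
    D ℕ.* cost L x   ≤⟨ ℕₚ.*-monoʳ-≤ D (l .bound x≤q) ⟩
    D ℕ.* (C ℕ.* x)  ≡⟨ ℕₚ.*-assoc D C x ⟨
    D ℕ.* C ℕ.* x    ≡⟨ ≡.cong (ℕ._* x) (ℕₚ.*-comm D C) ⟩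
    C ℕ.* D ℕ.* x    ∎
    where open ℕₚ.≤-Reasoning

  ∏ : ∀ n → (Fin n → Carrier) → Carrier
  ∏ zero    f = 1#
  ∏ (suc n) f = f fzero * ∏ n (f ∘ fsuc)

  ⨂ : ∀ n → (Fin n → List Term) → List Term
  ⨂ zero    G = (0 , λ _ → 1#) ∷ []
  ⨂ (suc n) G = G fzero ⊗ ⨂ n (G ∘ fsuc)

  Span-unit : ∀ K → Span ((0 , K) ∷ []) K
  Span-unit K = cons 1# (λ j → sym (begin
    1# * 1# * K j + 0# ≈⟨ +-identityʳ _ ⟩
    1# * 1# * K j      ≈⟨ *-congʳ (*-identityˡ 1#) ⟩
    1# * K j           ≈⟨ *-identityˡ _ ⟩
    K j                ∎)) (nil λ _ → refl)
    where open ≈-Reasoning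

  Cost≤-unit : ∀ {q} K → Cost≤ q 1 ((0 , K) ∷ [])
  Cost≤-unit K .bound _ = ℕₚ.≤-refl

  Span-⨂ : ∀ n {G : Fin n → List Term} {g : Fin n → J → Carrier} → (∀ i → Span (G i) (g i)) →
           Span (⨂ n G) (λ j → ∏ n (λ i → g i j))
  Span-⨂ zero    s = Span-unit (λ _ → 1#)
  Span-⨂ (suc n) s = Span-⊗ (s fzero) (Span-⨂ n (s ∘ fsuc))

  Cost≤-⨂ : ∀ {q C} n G → (∀ i → Cost≤ q C (G i)) → Cost≤ q (C ℕ.^ n) (⨂ n G)
  Cost≤-⨂ zero    G l = Cost≤-unit (λ _ → 1#)
  Cost≤-⨂ (suc n) G l = Cost≤-⊗ (G fzero) _ (l fzero) (Cost≤-⨂ n (G ∘ fsuc) (l ∘ fsuc))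

  -- One summand for each position of the first unit coordinate: P i serves the
  -- coordinates before it, K i the unit coordinate itself, G i those after it.
  charts : ∀ n → (P G : Fin n → List Term) → (Fin n → J → Carrier) → List Term
  charts zero    P G K = []
  charts (suc n) P G K =
    (((0 , K fzero) ∷ []) ⊗ ⨂ n (G ∘ fsuc)) ++
    (P fzero ⊗ charts n (P ∘ fsuc) (G ∘ fsuc) (K ∘ fsuc))

  -- A row uses only the summand that belongs to its own `i₀` and takes coefficient zero in the
  -- others; thus one list covers all charts.
  Span-charts : ∀ n {P G : Fin n → List Term} {K} {g : Fin n → J → Carrier} i₀ →
                (∀ i → i <ᶠ i₀ → Span (P i) (g i)) →
                (∀ j → g i₀ j ≈ K i₀ j) →
                (∀ i → Span (G i) (g i)) →
                Span (charts n P G K) (λ j → ∏ n (λ i → g i j))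
  Span-charts (suc n) fzero p≈ k≈ g≈ = Span-++ˡ _
    (Span-⊗ (Span-cong (sym ∘ k≈) (Span-unit _)) (Span-⨂ n (g≈ ∘ fsuc)))
  Span-charts (suc n) {G = G} {K} (fsuc i₀) p≈ k≈ g≈ =
    Span-++ʳ (((0 , K fzero) ∷ []) ⊗ ⨂ n (G ∘ fsuc))
      (Span-⊗ (p≈ fzero (s≤s z≤n))
        (Span-charts n i₀ (λ i i<i₀ → p≈ (fsuc i) (s≤s i<i₀)) k≈ (g≈ ∘ fsuc)))

  Cost≤-charts : ∀ {q C D} n P G K → (∀ i → Cost≤ q D (P i)) → (∀ i → Cost≤ q C (G i)) →
                 Cost≤ q (chartBound C D n) (charts n P G K)
  Cost≤-charts zero    P G K p g .bound _ = z≤n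
  Cost≤-charts {q} {C} {D} (suc n) P G K p g = Cost≤-++
    (((0 , K fzero) ∷ []) ⊗ ⨂ n (G ∘ fsuc)) _
    (≡.subst (λ B → Cost≤ q B _) (ℕₚ.*-identityˡ (C ℕ.^ n))
      (Cost≤-⊗ ((0 , K fzero) ∷ []) (⨂ n (G ∘ fsuc)) (Cost≤-unit (K fzero))
        (Cost≤-⨂ n (G ∘ fsuc) (g ∘ fsuc))))
    (Cost≤-⊗ (P fzero) _ (p fzero)
      (Cost≤-charts n (P ∘ fsuc) (G ∘ fsuc) (K ∘ fsuc) (p ∘ fsuc) (g ∘ fsuc)))

-- Newton interpolation of powers over a commutative ring

module Newton {c ℓ} (R : CommutativeRing c ℓ) (a : ℕ → CommutativeRing.Carrier R) where

  open CommutativeRing R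
  open import Algebra.Properties.Semiring.Exp semiring using (_^_)
  open import Algebra.Properties.Group +-group using (//-rightDividesˡ)
  open import Algebra.Solver.Ring.NaturalCoefficients.Default commutativeSemiring
    using (solve; _:+_; _:*_; _:=_; con)
  open import Relation.Binary.Reasoning.Setoid setoid
  open RangeFold +-commutativeMonoid using (fold; fold-head; fold-ε)
  module Product = RangeFold *-commutativeMonoid

  nodal : Carrier → ℕ → Carrier
  nodal y t = Product.fold t (λ c → y - a c)

  -- The complete homogeneous polynomial of degree v ∸ t in a 0 , … , a t.
  κ : ℕ → ℕ → Carrier
  κ zero    zero    = 1#
  κ (suc t) zero    = 0#
  κ zero    (suc v) = a 0 * κ 0 v
  κ (suc t) (suc v) = κ t v + a (suc t) * κ (suc t) v

  κ-vanishes : ∀ {t v} → v < t → κ t v ≈ 0#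
  κ-vanishes {suc t} {zero}  _         = refl
  κ-vanishes {suc t} {suc v} (s≤s v<t) = begin
    κ t v + a (suc t) * κ (suc t) v
      ≈⟨ +-cong (κ-vanishes v<t) (*-congˡ (κ-vanishes (ℕₚ.m<n⇒m<1+n v<t))) ⟩
    0# + a (suc t) * 0# ≈⟨ +-identityˡ _ ⟩
    a (suc t) * 0#      ≈⟨ zeroʳ _ ⟩
    0#                  ∎

  interpolant : Carrier → ℕ → ℕ → Carrier
  interpolant y n v = fold n (λ t → nodal y t * κ t v)

  -- Since `y = (y - a t) + a t`, multiplying the nodal product of index `t` by `y` gives the next
  -- one plus `a t` times itself. Collecting these contributions is the recursion of `κ`; only the
  -- topmost nodal product is left over.
  interpolant-suc : ∀ y T v →
    interpolant y (suc T) (suc v) + nodal y (suc T) * κ T v ≈ y * interpolant y (suc T) v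
  interpolant-suc y zero v = begin
    (0# + 1# * (a 0 * κ 0 v)) + (1# * (y - a 0)) * κ 0 v
      ≈⟨ solve 3 (λ d a₀ k → (con 0 :+ con 1 :* (a₀ :* k)) :+ (con 1 :* d) :* k :=
                             (d :+ a₀) :* (con 0 :+ con 1 :* k)) refl (y - a 0) (a 0) (κ 0 v) ⟩
    (y - a 0 + a 0) * (0# + 1# * κ 0 v)
      ≈⟨ *-congʳ (//-rightDividesˡ (a 0) y) ⟩
    y * (0# + 1# * κ 0 v) ∎
  interpolant-suc y (suc T) v = begin
    (S′ + N * (κ T v + a (suc T) * k)) + (N * (y - a (suc T))) * k
      ≈⟨ solve 6 (λ s n k₀ b k d →
           (s :+ n :* (k₀ :+ b :* k)) :+ (n :* d) :* k :=
           (s :+ n :* k₀) :+ (d :+ b) :* (n :* k))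
           refl S′ N (κ T v) (a (suc T)) k (y - a (suc T)) ⟩
    (S′ + N * κ T v) + (y - a (suc T) + a (suc T)) * (N * k)
      ≈⟨ +-cong (interpolant-suc y T v) (*-congʳ (//-rightDividesˡ (a (suc T)) y)) ⟩
    y * interpolant y (suc T) v + y * (N * k)
      ≈⟨ distribˡ _ _ _ ⟨
    y * interpolant y (suc (suc T)) v ∎
    where
    S′ N k : Carrier
    S′ = interpolant y (suc T) (suc v)
    N  = nodal y (suc T)
    k  = κ (suc T) v

  power-interpolant : ∀ y n v → v < n → y ^ v ≈ interpolant y n v
  power-interpolant y (suc n) zero _ = sym (begin
    interpolant y (suc n) 0
      ≈⟨ fold-head n _ ⟩
    1# * 1# + fold n (λ t → nodal y (suc t) * 0#)
      ≈⟨ +-cong (*-identityˡ 1#) (fold-ε n λ _ → zeroʳ _) ⟩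
    1# + 0#
      ≈⟨ +-identityʳ 1# ⟩
    1# ∎)
  power-interpolant y (suc (suc n)) (suc v) (s≤s v<1+n) = begin
    y * y ^ v
      ≈⟨ *-congˡ (power-interpolant y (suc n) v v<1+n) ⟩
    y * interpolant y (suc n) v
      ≈⟨ interpolant-suc y n v ⟨
    interpolant y (suc n) (suc v) + nodal y (suc n) * κ n v
      -- The leftover is exactly the summand with `t = suc n`, because `κ (suc n) v` vanishes.
      ≈⟨ +-congˡ (*-congˡ (trans (+-congˡ (trans (*-congˡ (κ-vanishes v<1+n)) (zeroʳ _)))
                                 (+-identityʳ _))) ⟨
    interpolant y (suc (suc n)) (suc v) ∎

-- The Frobenius identity in characteristic `p`

module Frobenius {c ℓ} (R : CommutativeRing c ℓ) where

  open CommutativeRing R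
  open import Algebra.Properties.Semiring.Exp semiring using (_^_; ^-congˡ; ^-assocʳ)
  open import Algebra.Properties.Semiring.Mult semiring using (×-assocˡ) renaming (_×_ to _·_)
  open import Algebra.Properties.CommutativeSemiring.Binomial commutativeSemiring
    using (theorem; binomialTerm)
  open import Algebra.Properties.Semiring.Sum semiring
    using (sum-init-last; sum-cong-≋; sum-replicate-zero) renaming (sum to ∑′)
  open import Data.Fin using (Fin; inject₁; fromℕ) renaming (suc to fsuc)
  open import Data.Fin.Properties using (toℕ<n; toℕ-inject₁; toℕ-fromℕ)
  open import Data.Nat using (_!)
  open import Data.Nat.Combinatorics using (_C_; nCn≡1; nCk≡n!/k![n-k]!; k![n∸k]!∣n!)
  open import Data.Nat.Divisibility using (_∣_; divides; m∣m*n; ∣⇒≤; ∣1⇒≡1)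
  open import Data.Nat.DivMod using (m/n*n≡m)
  open import Data.Nat.Primality
    using (Prime; euclidsLemma; ¬prime[1])
  open import Relation.Binary.Reasoning.Setoid setoid

  p∤m! : ∀ {p} → Prime p → ∀ m → m < p → ¬ p ∣ m !
  p∤m! pp zero    m<p p∣ = ¬prime[1] (≡.subst Prime (∣1⇒≡1 p∣) pp)
  p∤m! pp (suc m) m<p p∣ with euclidsLemma (suc m) (m !) pp p∣
  ... | inj₁ p∣1+m = ℕₚ.<⇒≱ m<p (∣⇒≤ p∣1+m)
  ... | inj₂ p∣m!  = p∤m! pp m (ℕₚ.<-trans (ℕₚ.n<1+n m) m<p) p∣m!

  nCk*k![n∸k]!≡n! : ∀ {n k} → k ≤ n → (n C k) ℕ.* (k ! ℕ.* (n ∸ k) !) ≡ n !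
  nCk*k![n∸k]!≡n! {n} {k} k≤n = ≡.trans
    (≡.cong (ℕ._* (k ! ℕ.* (n ∸ k) !)) (nCk≡n!/k![n-k]! k≤n))
    (m/n*n≡m (k![n∸k]!∣n! k≤n))
    where instance _ = k ℕₚ.!* (n ∸ k) !≢0

  p∣pCk : ∀ {p k} → Prime p → 0 < k → k < p → p ∣ p C k
  p∣pCk {p@(suc n)} {k} pp 0<k k<p
    with euclidsLemma (p C k) (k ! ℕ.* (p ∸ k) !) pp
           (≡.subst (p ∣_) (≡.sym (nCk*k![n∸k]!≡n! (ℕₚ.<⇒≤ k<p))) (m∣m*n (n !)))
  ... | inj₁ p∣C = p∣C
  ... | inj₂ p∣! with euclidsLemma (k !) ((p ∸ k) !) pp p∣!
  ...   | inj₁ p∣k! = contradiction p∣k! (p∤m! pp k k<p)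
  ...   | inj₂ p∣r! = contradiction p∣r!
          (p∤m! pp (p ∸ k) (ℕₚ.∸-monoʳ-< 0<k (ℕₚ.<⇒≤ k<p)))

  p∣m⇒m·x≈0 : ∀ {p m} → (∀ x → p · x ≈ 0#) → ∀ x → p ∣ m → m · x ≈ 0#
  p∣m⇒m·x≈0 {p} char x (divides d ≡.refl) = begin
    (d ℕ.* p) · x ≡⟨ ≡.cong (_· x) (ℕₚ.*-comm d p) ⟩
    (p ℕ.* d) · x ≈⟨ ×-assocˡ x p d ⟨
    p · (d · x)   ≈⟨ char _ ⟩
    0#            ∎

  frobenius : ∀ {p} → Prime p → (∀ x → p · x ≈ 0#) → ∀ x y → (x + y) ^ p ≈ x ^ p + y ^ p
  frobenius {p@(suc n)} pp char x y = begin
    (x + y) ^ p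
      ≈⟨ theorem p x y ⟩
    1 · (1# * y ^ p) + ∑′ tail
      ≈⟨ +-cong (trans (+-identityʳ _) (*-identityˡ _)) (sum-init-last tail) ⟩
    y ^ p + (∑′ (λ i → tail (inject₁ i)) + tail (fromℕ n))
      ≈⟨ +-congˡ (+-cong (trans (sum-cong-≋ middle) (sum-replicate-zero n)) last) ⟩
    y ^ p + (0# + x ^ p)
      ≈⟨ +-congˡ (+-identityˡ _) ⟩
    y ^ p + x ^ p
      ≈⟨ +-comm _ _ ⟩
    x ^ p + y ^ p ∎
    where
    tail : Fin p → Carrier
    tail i = binomialTerm x y p (fsuc i)
    middle : ∀ i → tail (inject₁ i) ≈ 0#
    middle i = p∣m⇒m·x≈0 char _ (p∣pCk pp (s≤s z≤n)
      (s≤s (≡.subst (_< n) (≡.sym (toℕ-inject₁ i)) (toℕ<n i))))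
    last : tail (fromℕ n) ≈ x ^ p
    last rewrite toℕ-fromℕ n | nCn≡1 p | ℕₚ.n∸n≡0 n =
      trans (+-identityʳ _) (*-identityʳ _)

  frobenius^ : ∀ {p} → Prime p → (∀ x → p · x ≈ 0#) → ∀ j x y →
               (x + y) ^ (p ℕ.^ j) ≈ x ^ (p ℕ.^ j) + y ^ (p ℕ.^ j)
  frobenius^ pp char zero    x y =
    trans (*-identityʳ _) (sym (+-cong (*-identityʳ x) (*-identityʳ y)))
  frobenius^ {p} pp char (suc j) x y = begin
    (x + y) ^ (p ℕ.* p ℕ.^ j)
      ≈⟨ ^-assocʳ (x + y) p (p ℕ.^ j) ⟨
    ((x + y) ^ p) ^ (p ℕ.^ j)
      ≈⟨ ^-congˡ (p ℕ.^ j) (frobenius pp char x y) ⟩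
    (x ^ p + y ^ p) ^ (p ℕ.^ j)
      ≈⟨ frobenius^ pp char j (x ^ p) (y ^ p) ⟩
    (x ^ p) ^ (p ℕ.^ j) + (y ^ p) ^ (p ℕ.^ j)
      ≈⟨ +-cong (^-assocʳ x p (p ℕ.^ j)) (^-assocʳ y p (p ℕ.^ j)) ⟩
    x ^ (p ℕ.* p ℕ.^ j) + y ^ (p ℕ.* p ℕ.^ j) ∎

-- Orders of nodal products and the terms of one coordinate

module Coordinate {c ℓ} (R : CommutativeRing c ℓ) where

  open CommutativeRing R
  open import Algebra.Properties.Semiring.Exp semiring
    using (_^_; ^-congˡ; ^-homo-*; ^-assocʳ)
  open import Algebra.Properties.Semiring.Mult semiring using () renaming (_×_ to _·_)
  open import Algebra.Properties.Semiring.Divisibility semiring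
    using (_∣_; ∣-trans; ∣-refl)
  open import Algebra.Properties.CommutativeSemigroup.Divisibility *-commutativeSemigroup
    using (∙-cong-∣)
  open import Algebra.Properties.Group +-group using (⁻¹-anti-homo-//; //-rightDividesʳ)
  open import Algebra.Properties.Ring ring using (-‿distribˡ-*)
  open import Algebra.Definitions.RawMagma *-rawMagma using (_,_)
  open import Algebra.Solver.Ring.NaturalCoefficients.Default commutativeSemiring
    using (solve; _:+_; _:*_; _:=_; con)
  open import Data.List using (List; applyUpTo)
  open import Data.Nat.Divisibility using (∣m+n∣m⇒∣n)
    renaming (_∣_ to _∣ₙ_; divides to dividesₙ; ∣-trans to ∣ₙ-trans)
  open import Data.Nat.Primality using (Prime; prime⇒nonZero)
  open import Relation.Binary.Reasoning.Setoid setoid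

  ^-∣-^ : ∀ x {m n} → m ≤ n → x ^ m ∣ x ^ n
  ^-∣-^ x {m} {n} m≤n = x ^ (n ∸ m) , trans (sym (^-homo-* x (n ∸ m) m))
    (reflexive (≡.cong (x ^_) (ℕₚ.m∸n+n≡m m≤n)))

  x≈y+qm⇒m∣x-y : ∀ {x y q m} → x ≈ y + q * m → m ∣ x - y
  x≈y+qm⇒m∣x-y {x} {y} {q} {m} eq = q , (begin
    q * m           ≈⟨ //-rightDividesʳ y (q * m) ⟨
    q * m + y - y   ≈⟨ +-congʳ (trans (+-comm _ _) (sym eq)) ⟩
    x - y           ∎)

  m∣x-y⇒m∣y-x : ∀ {x y m} → m ∣ x - y → m ∣ y - x
  m∣x-y⇒m∣y-x {x} {y} (q , eq) =
    - q , trans (sym (-‿distribˡ-* q _)) (trans (-‿cong eq) (⁻¹-anti-homo-// x y))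

  [1+x]^n : ∀ x n → ∃ λ q → (1# + x) ^ n ≈ 1# + q * x
  [1+x]^n x zero    = 0# , sym (trans (+-congˡ (zeroˡ x)) (+-identityʳ 1#))
  [1+x]^n x (suc n) with q , eq ← [1+x]^n x n = 1# + (1# + x) * q , (begin
    (1# + x) * (1# + x) ^ n    ≈⟨ *-congˡ eq ⟩
    (1# + x) * (1# + q * x)
      ≈⟨ solve 2 (λ x q → (con 1 :+ x) :* (con 1 :+ q :* x) :=
                         con 1 :+ (con 1 :+ (con 1 :+ x) :* q) :* x) refl x q ⟩
    1# + (1# + (1# + x) * q) * x ∎)

  module _ {p} (pp : Prime p) (char : ∀ x → p · x ≈ 0#) where

    open Frobenius R using (frobenius^)
    open WindowWeights p {{prime⇒nonZero pp}}

    private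
      1^n≈1 : ∀ n → 1# ^ n ≈ 1#
      1^n≈1 zero    = refl
      1^n≈1 (suc n) = trans (*-identityˡ _) (1^n≈1 n)

    module _ (x : Carrier) where

      private
        z : Carrier
        z = 1# + x

      z^[p^i] : ∀ i → z ^ (p ℕ.^ i) ≈ 1# + x ^ (p ℕ.^ i)
      z^[p^i] i = trans (frobenius^ pp char i 1# x) (+-congʳ (1^n≈1 (p ℕ.^ i)))

      -- For `d = a * p ^ i`, Frobenius turns `z ^ d` into `(1 + x ^ (p ^ i)) ^ a`, which is `1`
      -- modulo `x ^ (p ^ i)`.
      z^b-z^[b+d] : ∀ i {d} b → p ℕ.^ i ∣ₙ d → x ^ (p ℕ.^ i) ∣ z ^ (b ℕ.+ d) - z ^ b
      z^b-z^[b+d] i b (dividesₙ a ≡.refl)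
        with q , eq ← [1+x]^n (x ^ (p ℕ.^ i)) a = x≈y+qm⇒m∣x-y (begin
          z ^ (b ℕ.+ a ℕ.* p ℕ.^ i)
            ≈⟨ ^-homo-* z b (a ℕ.* p ℕ.^ i) ⟩
          z ^ b * z ^ (a ℕ.* p ℕ.^ i)
            ≡⟨ ≡.cong (λ n → z ^ b * z ^ n) (ℕₚ.*-comm a (p ℕ.^ i)) ⟩
          z ^ b * z ^ (p ℕ.^ i ℕ.* a)
            ≈⟨ *-congˡ (^-assocʳ z (p ℕ.^ i) a) ⟨
          z ^ b * (z ^ (p ℕ.^ i)) ^ a
            ≈⟨ *-congˡ (trans (^-congˡ a (z^[p^i] i)) eq) ⟩
          z ^ b * (1# + q * x ^ (p ℕ.^ i))
            ≈⟨ trans (distribˡ _ _ _) (+-cong (*-identityʳ _) (sym (*-assoc _ _ _))) ⟩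
          z ^ b + (z ^ b * q) * x ^ (p ℕ.^ i) ∎)

      -- β stands for - b, so that the hypotheses say b ≡ e modulo p ^ i.
      z^b-z^e : ∀ i {β} b e → p ℕ.^ i ∣ₙ β ℕ.+ b → p ℕ.^ i ∣ₙ β ℕ.+ e →
                x ^ (p ℕ.^ i) ∣ z ^ b - z ^ e
      z^b-z^e i {β} b e ∣b ∣e with ℕₚ.≤-total b e
      ... | inj₁ b≤e = m∣x-y⇒m∣y-x
        (≡.subst (λ n → x ^ (p ℕ.^ i) ∣ z ^ n - z ^ b) (ℕₚ.m+[n∸m]≡n b≤e)
          (z^b-z^[b+d] i b (∣m+n∣m⇒∣n (≡.subst (p ℕ.^ i ∣ₙ_) (≡.sym (split b≤e)) ∣e) ∣b)))
        where
        split : b ≤ e → (β ℕ.+ b) ℕ.+ (e ∸ b) ≡ β ℕ.+ e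
        split b≤e = ≡.trans (ℕₚ.+-assoc β b _) (≡.cong (β ℕ.+_) (ℕₚ.m+[n∸m]≡n b≤e))
      ... | inj₂ e≤b =
        ≡.subst (λ n → x ^ (p ℕ.^ i) ∣ z ^ n - z ^ e) (ℕₚ.m+[n∸m]≡n e≤b)
          (z^b-z^[b+d] i e (∣m+n∣m⇒∣n (≡.subst (p ℕ.^ i ∣ₙ_) (≡.sym (split e≤b)) ∣b) ∣e))
        where
        split : e ≤ b → (β ℕ.+ e) ℕ.+ (b ∸ e) ≡ β ℕ.+ b
        split e≤b = ≡.trans (ℕₚ.+-assoc β e _) (≡.cong (β ℕ.+_) (ℕₚ.m+[n∸m]≡n e≤b))

      open Newton R (z ^_)

      -- As `β ≡ - b`, the number `β + e` has the same p-part, cut off at `p ^ j`, as `e - b`, and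
      -- this bounds the order of the factor `z ^ b - z ^ e`.
      nodal-∣ : ∀ j {β} b → p ℕ.^ j ∣ₙ β ℕ.+ b → ∀ t →
                x ^ sum t (λ e → ω j (β ℕ.+ e)) ∣ nodal (z ^ b) t
      nodal-∣ j b ∣b zero    = ∣-refl
      nodal-∣ j {β} b ∣b (suc t)
        with i , i≤j , eq , ∣t ← ω-power j (β ℕ.+ t) =
        ∣-trans (1# , trans (*-identityˡ _) (^-homo-* x (sum t λ e → ω j (β ℕ.+ e)) (ω j (β ℕ.+ t))))
          (∙-cong-∣ (nodal-∣ j b ∣b t)
            (≡.subst (λ n → x ^ n ∣ z ^ b - z ^ t) (≡.sym eq)
              (z^b-z^e i {β} b t (∣ₙ-trans (p^i∣p^j i≤j) ∣b) ∣t)))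
        where
        p^i∣p^j : ∀ {i j} → i ≤ j → p ℕ.^ i ∣ₙ p ℕ.^ j
        p^i∣p^j {i} {j} i≤j = dividesₙ (p ℕ.^ (j ∸ i)) (≡.trans
          (≡.cong (p ℕ.^_) (≡.sym (ℕₚ.m∸n+n≡m i≤j))) (ℕₚ.^-distribˡ-+-* p (j ∸ i) i))

      nodal-windowWeight : ∀ j b t → x ^ windowWeight j t ∣ nodal (z ^ b) t
      nodal-windowWeight j b t =
        ∣-trans (^-∣-^ x (windowWeight-≤ j β t)) (nodal-∣ (suc j) {β} b ∣β+b t)
        where
        -- A negative of `b` modulo `p ^ suc j` inside ℕ: `β + b = p ^ suc j * b`.
        β : ℕ
        β = ℕ.pred (p ℕ.^ suc j) ℕ.* b
        ∣β+b : p ℕ.^ suc j ∣ₙ β ℕ.+ b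
        ∣β+b = dividesₙ b (≡.trans (ℕₚ.+-comm β b) (≡.trans
          (≡.cong (ℕ._* b) (ℕₚ.suc-pred (p ℕ.^ suc j) {{p^j≢0 (suc j)}}))
          (ℕₚ.*-comm (p ℕ.^ suc j) b)))

    module _ (w : Carrier) (J : Set) where

      open WeightedSpan R w J

      -- e is the exponent with 1# + w ^ e the base of the powers: 1 for
      -- a general coordinate, p for one divisible by p.
      coordinate : (e j n : ℕ) → (J → ℕ) → List Term
      coordinate e j n v =
        applyUpTo (λ t → e ℕ.* windowWeight j t , λ i → κ t (v i)) n
        where open Newton R ((1# + w ^ e) ^_)

      Span-coordinate : ∀ e j n {v} → (∀ i → v i < n) → ∀ b →
                        Span (coordinate e j n v) (λ i → ((1# + w ^ e) ^ b) ^ v i)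
      Span-coordinate e j n {v} v<n b = Span-cong
        (λ i → sym (power-interpolant _ n (v i) (v<n i)))
        (Span-applyUpTo n (nodal _) λ t →
          ∣-trans (1# , trans (*-identityˡ _) (sym (^-assocʳ w e (windowWeight j t))))
                  (nodal-windowWeight (w ^ e) j b t))
        where open Newton R ((1# + w ^ e) ^_)

      Cost≤-coordinate : ∀ e j N {q v} →
        q ≤ e ℕ.* O (suc j) ℕ.+ (p ∸ 1) ℕ.* (e ℕ.* O j) → q ≤ 2 ℕ.* (e ℕ.* O (suc j)) →
        Cost≤ q (p ℕ.^ suc j) (coordinate e j ((2 ℕ.+ N) ℕ.* p ℕ.^ suc j) v)
      Cost≤-coordinate e j N {q} {v} q≤ q≤2 .Cost≤.bound {x} x≤q = ℕₚ.≤-trans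
        (ℕₚ.≤-reflexive (cost-applyUpTo ((2 ℕ.+ N) ℕ.* p ℕ.^ suc j) (λ t → e ℕ.* windowWeight j t)
          (λ t i → κ t (v i)) x))
        (cost-≤ j e N x (ℕₚ.≤-trans x≤q q≤) (ℕₚ.≤-trans x≤q q≤2))
        where open Newton R ((1# + w ^ e) ^_)

-- Formal power series and functionals on their coefficients

module PowerSeries {c ℓ} (K : CommutativeRing c ℓ) where

  open CommutativeRing K
  open import Algebra.Construct.Pointwise ℕ using () renaming (isAbelianGroup to pointwise)
  open import Algebra.Properties.CommutativeSemigroup +-commutativeSemigroup
    using (interchange)
  open import Algebra.Definitions.RawMagma *-rawMagma using () renaming (_,_ to _,ₖ_)
  open import Algebra.Properties.Semiring.Mult semiring using () renaming (_×_ to _·_)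
  open import Data.List using (List; []; _∷_; _++_; applyUpTo; length)
  open import Data.List.Properties using (length-++; length-applyUpTo)
  open import Relation.Binary.Reasoning.Setoid setoid
  open RangeFold +-commutativeMonoid

  Series : Set c
  Series = ℕ → Carrier

  infixl 7 _⊛_

  -- The Cauchy product, recursing on the tail of `f` so that no index is subtracted.
  _⊛_ : Series → Series → Series
  (f ⊛ g) zero    = f 0 * g 0
  (f ⊛ g) (suc n) = f 0 * g (suc n) + ((f ∘ suc) ⊛ g) n

  one : Series
  one zero    = 1#
  one (suc _) = 0#

  X : Series
  X zero    = 0#
  X (suc n) = one n

  ⊛-cong : ∀ {f f′ g g′} → (∀ n → f n ≈ f′ n) → (∀ n → g n ≈ g′ n) →
           ∀ n → (f ⊛ g) n ≈ (f′ ⊛ g′) n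
  ⊛-cong f≈ g≈ zero    = *-cong (f≈ 0) (g≈ 0)
  ⊛-cong f≈ g≈ (suc n) =
    +-cong (*-cong (f≈ 0) (g≈ (suc n))) (⊛-cong (f≈ ∘ suc) g≈ n)

  ⊛-sucʳ : ∀ f g n → (f ⊛ g) (suc n) ≈ (f ⊛ (g ∘ suc)) n + f (suc n) * g 0
  ⊛-sucʳ f g zero    = refl
  ⊛-sucʳ f g (suc n) = trans (+-congˡ (⊛-sucʳ (f ∘ suc) g n)) (sym (+-assoc _ _ _))

  ⊛-comm : ∀ f g n → (f ⊛ g) n ≈ (g ⊛ f) n
  ⊛-comm f g zero    = *-comm _ _
  ⊛-comm f g (suc n) = begin
    f 0 * g (suc n) + ((f ∘ suc) ⊛ g) n ≈⟨ +-cong (*-comm _ _) (⊛-comm (f ∘ suc) g n) ⟩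
    g (suc n) * f 0 + (g ⊛ (f ∘ suc)) n ≈⟨ +-comm _ _ ⟩
    (g ⊛ (f ∘ suc)) n + g (suc n) * f 0 ≈⟨ ⊛-sucʳ g f n ⟨
    (g ⊛ f) (suc n)                     ∎

  ⊛-distribʳ : ∀ h f g n → ((λ i → f i + g i) ⊛ h) n ≈ (f ⊛ h) n + (g ⊛ h) n
  ⊛-distribʳ h f g zero    = distribʳ _ _ _
  ⊛-distribʳ h f g (suc n) = trans
    (+-cong (distribʳ _ _ _) (⊛-distribʳ h (f ∘ suc) (g ∘ suc) n))
    (interchange _ _ _ _)

  ⊛-distribˡ : ∀ h f g n → (h ⊛ (λ i → f i + g i)) n ≈ (h ⊛ f) n + (h ⊛ g) n
  ⊛-distribˡ h f g n = trans (⊛-comm h _ n)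
    (trans (⊛-distribʳ h f g n) (+-cong (⊛-comm f h n) (⊛-comm g h n)))

  ⊛-scale : ∀ a f g n → ((λ i → a * f i) ⊛ g) n ≈ a * (f ⊛ g) n
  ⊛-scale a f g zero    = *-assoc _ _ _
  ⊛-scale a f g (suc n) = trans
    (+-cong (*-assoc _ _ _) (⊛-scale a (f ∘ suc) g n)) (sym (distribˡ _ _ _))

  ⊛-assoc : ∀ f g h n → ((f ⊛ g) ⊛ h) n ≈ (f ⊛ (g ⊛ h)) n
  ⊛-assoc f g h zero    = *-assoc _ _ _
  ⊛-assoc f g h (suc n) = begin
    f 0 * g 0 * h (suc n) + (((f ⊛ g) ∘ suc) ⊛ h) n
      ≈⟨ +-cong (*-assoc _ _ _)
           (trans (⊛-distribʳ h (λ i → f 0 * g (suc i)) _ n)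
             (+-cong (⊛-scale (f 0) (g ∘ suc) h n) (⊛-assoc (f ∘ suc) g h n))) ⟩
    f 0 * (g 0 * h (suc n)) + (f 0 * ((g ∘ suc) ⊛ h) n + ((f ∘ suc) ⊛ (g ⊛ h)) n)
      ≈⟨ +-assoc _ _ _ ⟨
    f 0 * (g 0 * h (suc n)) + f 0 * ((g ∘ suc) ⊛ h) n + ((f ∘ suc) ⊛ (g ⊛ h)) n
      ≈⟨ +-congʳ (distribˡ _ _ _) ⟨
    (f ⊛ (g ⊛ h)) (suc n) ∎

  ⊛-zeroˡ : ∀ {f} g → (∀ n → f n ≈ 0#) → ∀ n → (f ⊛ g) n ≈ 0#
  ⊛-zeroˡ g f≈0 zero    = trans (*-congʳ (f≈0 0)) (zeroˡ _)
  ⊛-zeroˡ g f≈0 (suc n) = trans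
    (+-cong (trans (*-congʳ (f≈0 0)) (zeroˡ _)) (⊛-zeroˡ g (f≈0 ∘ suc) n))
    (+-identityˡ 0#)

  ⊛-identityˡ : ∀ f n → (one ⊛ f) n ≈ f n
  ⊛-identityˡ f zero    = *-identityˡ _
  ⊛-identityˡ f (suc n) = trans
    (+-cong (*-identityˡ _) (⊛-zeroˡ f (λ _ → refl) n)) (+-identityʳ _)

  series : CommutativeRing c ℓ
  series = record
    { Carrier = Series
    ; _≈_ = λ f g → ∀ n → f n ≈ g n
    ; _+_ = λ f g n → f n + g n
    ; _*_ = _⊛_
    ; -_ = λ f n → - f n
    ; 0# = λ _ → 0#
    ; 1# = one
    ; isCommutativeRing = record
      { isRing = record
        { +-isAbelianGroup = pointwise +-isAbelianGroup
        ; *-cong = ⊛-cong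
        ; *-assoc = ⊛-assoc
        ; *-identity = ⊛-identityˡ , λ f n → trans (⊛-comm f one n) (⊛-identityˡ f n)
        ; distrib = ⊛-distribˡ , ⊛-distribʳ
        }
      ; *-comm = ⊛-comm
      }
    }

  module S = CommutativeRing series
  open import Algebra.Properties.Semiring.Exp S.semiring using (_^_)
  open import Algebra.Properties.Semiring.Divisibility S.semiring using (_∣_)
  open import Algebra.Properties.Semiring.Mult S.semiring using () renaming (_×_ to _·ₛ_)
  open import Algebra.Definitions.RawMagma S.*-rawMagma using (_,_)

  series-× : ∀ m f n → (m ·ₛ f) n ≈ m · f n
  series-× zero    f n = refl
  series-× (suc m) f n = +-congˡ (series-× m f n)

  X⊛ : ∀ f n → (X ⊛ f) (suc n) ≈ f n
  X⊛ f n = trans (+-cong (zeroˡ _) (⊛-identityˡ f n)) (+-identityˡ _)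

  -- The functional Σ_{d<D} c d [w^d].
  pair : ℕ → (ℕ → Carrier) → Series → Carrier
  pair D c f = fold D (λ d → c d * f d)

  pair-congʳ : ∀ D c {f g} → (∀ n → f n ≈ g n) → pair D c f ≈ pair D c g
  pair-congʳ D c eq = fold-cong D λ d _ → *-congˡ (eq d)

  pair-+ : ∀ D c f g → pair D c (λ n → f n + g n) ≈ pair D c f + pair D c g
  pair-+ D c f g =
    trans (fold-cong D λ d _ → distribˡ _ _ _) (fold-∙ D _ _)

  pair-+ˡ : ∀ D c c′ f → pair D (λ n → c n + c′ n) f ≈ pair D c f + pair D c′ f
  pair-+ˡ D c c′ f =
    trans (fold-cong D λ d _ → distribʳ _ _ _) (fold-∙ D _ _)

  pair-X : ∀ D c f → pair D c (X ⊛ f) ≈ pair (D ∸ 1) (c ∘ suc) f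
  pair-X zero    c f = refl
  pair-X (suc D) c f = begin
    pair (suc D) c (X ⊛ f)
      ≈⟨ fold-head D _ ⟩
    c 0 * (0# * f 0) + pair D (c ∘ suc) ((X ⊛ f) ∘ suc)
      ≈⟨ +-cong (trans (*-congˡ (zeroˡ _)) (zeroʳ _)) (pair-congʳ D (c ∘ suc) (X⊛ f)) ⟩
    0# + pair D (c ∘ suc) f
      ≈⟨ +-identityˡ _ ⟩
    pair D (c ∘ suc) f ∎

  -- A factor `X ^ o` leaves only `D ∸ o` coefficients of `f` to be read; this is where the summands
  -- `x ∸ o` of `cost` come from.
  pair-X^ : ∀ o D c f → pair D c (X ^ o ⊛ f) ≈ pair (D ∸ o) (λ d → c (o ℕ.+ d)) f
  pair-X^ zero    D c f = pair-congʳ D c (⊛-identityˡ f)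
  pair-X^ (suc o) D c f = begin
    pair D c (X ⊛ X ^ o ⊛ f)
      ≈⟨ pair-congʳ D c (⊛-assoc X (X ^ o) f) ⟩
    pair D c (X ⊛ (X ^ o ⊛ f))
      ≈⟨ pair-X D c (X ^ o ⊛ f) ⟩
    pair (D ∸ 1) (c ∘ suc) (X ^ o ⊛ f)
      ≈⟨ pair-X^ o (D ∸ 1) (c ∘ suc) f ⟩
    pair (D ∸ 1 ∸ o) (λ d → c (suc o ℕ.+ d)) f
      ≡⟨ ≡.cong (λ E → pair E (λ d → c (suc o ℕ.+ d)) f) (ℕₚ.∸-+-assoc D 1 o) ⟩
    pair (D ∸ suc o) (λ d → c (suc o ℕ.+ d)) f ∎

  truncate : ℕ → (ℕ → Carrier) → ℕ → Carrier
  truncate zero    c _       = 0#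
  truncate (suc D) c zero    = c 0
  truncate (suc D) c (suc d) = truncate D (c ∘ suc) d

  pair-truncate : ∀ D c f → pair (suc D) (truncate D c) f ≈ pair D c f
  pair-truncate zero    c f = trans (+-identityˡ _) (zeroˡ _)
  pair-truncate (suc D) c f = begin
    pair (suc (suc D)) (truncate (suc D) c) f
      ≈⟨ fold-head (suc D) _ ⟩
    c 0 * f 0 + pair (suc D) (truncate D (c ∘ suc)) (f ∘ suc)
      ≈⟨ +-congˡ (pair-truncate D (c ∘ suc) (f ∘ suc)) ⟩
    c 0 * f 0 + pair D (c ∘ suc) (f ∘ suc)
      ≈⟨ fold-head D _ ⟨
    pair (suc D) c f ∎

  -- The coefficients of `e ⊛ f` below `D` involve only those of `f` below `D`, so multiplication by
  -- `e` can be moved onto the functional. Row-dependent scalars are absorbed in this way.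
  pair-adjoint : ∀ D c e → ∃ λ c′ → ∀ f → pair D c (e ⊛ f) ≈ pair D c′ f
  pair-adjoint zero    c e = c , λ f → refl
  pair-adjoint (suc D) c e with c′ , eq ← pair-adjoint D (c ∘ suc) (e ∘ suc) =
    -- The part with `e 0` keeps the degree. The tail of `e` raises it by one, so its functional has
    -- length `D` and is padded by a zero.
    (λ d → c d * e 0 + truncate D c′ d) , λ f → begin
      pair (suc D) c (e ⊛ f)
        ≈⟨ fold-head D _ ⟩
      c 0 * (e 0 * f 0) + pair D (c ∘ suc) ((e ⊛ f) ∘ suc)
        ≈⟨ +-congˡ (pair-+ D (c ∘ suc) (λ d → e 0 * f (suc d)) ((e ∘ suc) ⊛ f)) ⟩
      c 0 * (e 0 * f 0) +
        (pair D (c ∘ suc) (λ d → e 0 * f (suc d)) + pair D (c ∘ suc) ((e ∘ suc) ⊛ f))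
        ≈⟨ +-assoc _ _ _ ⟨
      c 0 * (e 0 * f 0) + pair D (c ∘ suc) (λ d → e 0 * f (suc d)) +
        pair D (c ∘ suc) ((e ∘ suc) ⊛ f)
        ≈⟨ +-cong (sym (fold-head D _)) (eq f) ⟩
      pair (suc D) c (λ d → e 0 * f d) + pair D c′ f
        ≈⟨ +-cong (fold-cong (suc D) λ d _ → sym (*-assoc _ _ _))
                  (sym (pair-truncate D c′ f)) ⟩
      pair (suc D) (λ d → c d * e 0) f + pair (suc D) (truncate D c′) f
        ≈⟨ pair-+ˡ (suc D) _ _ f ⟨
      pair (suc D) (λ d → c d * e 0 + truncate D c′ d) f ∎

  z : Series
  z = one S.+ X

  -- The coefficients (Δ^d f)(0), with Δ f x = f (x + 1) - f x.
  differences : (ℕ → Carrier) → ℕ → Carrier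
  differences f zero    = f 0
  differences f (suc d) = differences (λ x → f (suc x) - f x) d

  -- The coefficient of `z ^ x` in degree `d` is the binomial coefficient of `x` over `d`, so this
  -- is the forward difference formula; `x < D` ensures that no term is cut off. The induction uses
  -- `z ^ suc x = z ^ x + X ⊛ z ^ x`.
  pair-differences : ∀ D f x → x < D → pair D (differences f) (z ^ x) ≈ f x
  pair-differences (suc D) f zero _ = begin
    pair (suc D) (differences f) one
      ≈⟨ fold-head D _ ⟩
    f 0 * 1# + pair D (differences f ∘ suc) (λ _ → 0#)
      ≈⟨ +-cong (*-identityʳ _) (fold-ε D λ _ → zeroʳ _) ⟩
    f 0 + 0#
      ≈⟨ +-identityʳ _ ⟩
    f 0 ∎
  pair-differences (suc D) f (suc x) (s≤s x<D) = begin
    pair (suc D) (differences f) (z ⊛ z ^ x)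
      ≈⟨ pair-congʳ (suc D) (differences f) (λ n → trans
           (⊛-distribʳ (z ^ x) one X n) (+-congʳ (⊛-identityˡ (z ^ x) n))) ⟩
    pair (suc D) (differences f) (λ n → (z ^ x) n + (X ⊛ z ^ x) n)
      ≈⟨ pair-+ (suc D) (differences f) (z ^ x) (X ⊛ z ^ x) ⟩
    pair (suc D) (differences f) (z ^ x) + pair (suc D) (differences f) (X ⊛ z ^ x)
      ≈⟨ +-cong (pair-differences (suc D) f x (ℕₚ.m<n⇒m<1+n x<D))
           (trans (pair-X (suc D) (differences f) (z ^ x))
             (pair-differences D (λ x → f (suc x) - f x) x x<D)) ⟩
    f x + (f (suc x) - f x)
      ≈⟨ +-comm _ _ ⟩
    f (suc x) - f x + f x
      ≈⟨ trans (+-assoc _ _ _) (trans (+-congˡ (-‿inverseˡ _)) (+-identityʳ _)) ⟩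
    f (suc x) ∎

  pair-∣ : ∀ q c f g → X ^ q ∣ f S.- g → pair q c f ≈ pair q c g
  pair-∣ q c f g (d , eq) = begin
    pair q c f
      ≈⟨ pair-congʳ q c (λ n → begin
           f n               ≈⟨ +-identityʳ _ ⟨
           f n + 0#          ≈⟨ +-congˡ (-‿inverseˡ _) ⟨
           f n + (- g n + g n) ≈⟨ +-assoc _ _ _ ⟨
           f n - g n + g n   ≈⟨ +-congʳ (trans (⊛-comm (X ^ q) d n) (eq n)) ⟨
           (X ^ q ⊛ d) n + g n ∎) ⟩
    pair q c (λ n → (X ^ q ⊛ d) n + g n)
      ≈⟨ pair-+ q c (X ^ q ⊛ d) g ⟩
    pair q c (X ^ q ⊛ d) + pair q c g
      ≈⟨ +-congʳ (pair-X^ q q c d) ⟩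
    pair (q ∸ q) _ d + pair q c g
      ≡⟨ ≡.cong (λ D → pair D (λ e → c (q ℕ.+ e)) d + pair q c g) (ℕₚ.n∸n≡0 q) ⟩
    0# + pair q c g
      ≈⟨ +-identityˡ _ ⟩
    pair q c g ∎

  module _ (J : Set) where

    module W = WeightedSpan series X J
    -- Over the field of coefficients only weight 0 is used.
    module L = WeightedSpan K 0# J

    coefficients : ℕ → List W.Term → List L.Term
    coefficients q []            = []
    coefficients q ((o , F) ∷ T) = applyUpTo (λ d → 0 , λ j → F j d) (q ∸ o) ++ coefficients q T

    length-coefficients : ∀ q T → length (coefficients q T) ≡ W.cost T q
    length-coefficients q []            = ≡.refl
    length-coefficients q ((o , F) ∷ T) = ≡.trans
      (length-++ (applyUpTo (λ d → 0 , λ j → F j d) (q ∸ o)))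
      (≡.cong₂ ℕ._+_ (length-applyUpTo _ (q ∸ o)) (length-coefficients q T))

    -- Passage from series scalars to scalars in `K`: on a term `X ^ o ⊛ e ⊛ F`, the functional
    -- becomes another one that reads the first `q ∸ o` coefficients of `F`, and those do not depend
    -- on the row.
    Span-coefficients : ∀ q c {T g} → W.Span T g →
                        L.Span (coefficients q T) (λ j → pair q c (g j))
    Span-coefficients q c (W.nil g≈0) = L.nil λ j →
      trans (fold-cong q λ d _ → trans (*-congˡ (g≈0 j d)) (zeroʳ (c d))) (fold-ε q λ _ → refl)
    Span-coefficients q c {(o , F) ∷ T} {g} (W.cons {h = h} e g≈ s)
      with c′ , adj ← pair-adjoint (q ∸ o) (λ d → c (o ℕ.+ d)) e =
      L.Span-cong
        (λ j → sym (begin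
          pair q c (g j)
            ≈⟨ trans (pair-congʳ q c (g≈ j)) (pair-+ q c (X ^ o ⊛ e ⊛ F j) (h j)) ⟩
          pair q c (X ^ o ⊛ e ⊛ F j) + pair q c (h j)
            ≈⟨ +-congʳ (pair-congʳ q c (⊛-assoc (X ^ o) e (F j))) ⟩
          pair q c (X ^ o ⊛ (e ⊛ F j)) + pair q c (h j)
            ≈⟨ +-congʳ (trans (pair-X^ o q c (e ⊛ F j)) (adj (F j))) ⟩
          pair (q ∸ o) c′ (F j) + pair q c (h j) ∎))
        (L.Span-++ (L.Span-applyUpTo (q ∸ o) c′ λ t → c′ t ,ₖ *-identityʳ (c′ t))
                   (Span-coefficients q c s))

-- Arithmetic modulo `p` on natural numbers

module Residues (p : ℕ) .{{_ : NonZero p}} where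

  open import Data.Nat using (_+_; _*_; _%_)
  open import Data.Nat.Divisibility using (_∣_; m%n≡0⇒n∣m; n∣m⇒m%n≡0; m∣m*n; _∣0)
  open import Data.Nat.DivMod using (%-distribˡ-+; %-distribˡ-*)

  infix 4 _≡ₚ_

  _≡ₚ_ : ℕ → ℕ → Set
  x ≡ₚ y = x % p ≡ y % p

  ∣⇒≡ₚ0 : ∀ {x} → p ∣ x → x ≡ₚ 0
  ∣⇒≡ₚ0 {x} p∣x = ≡.trans (n∣m⇒m%n≡0 x p p∣x) (≡.sym (n∣m⇒m%n≡0 0 p (p ∣0)))

  ≡ₚ0⇒∣ : ∀ {x} → x ≡ₚ 0 → p ∣ x
  ≡ₚ0⇒∣ {x} x≡0 = m%n≡0⇒n∣m x p (≡.trans x≡0 (n∣m⇒m%n≡0 0 p (p ∣0)))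

  +-congₚ : ∀ {x x′ y y′} → x ≡ₚ x′ → y ≡ₚ y′ → x + y ≡ₚ x′ + y′
  +-congₚ {x} {x′} {y} {y′} x≡ y≡ = ≡.trans (%-distribˡ-+ x y p)
    (≡.trans (≡.cong₂ (λ u v → (u + v) % p) x≡ y≡) (≡.sym (%-distribˡ-+ x′ y′ p)))

  *-congₚ : ∀ {x x′ y y′} → x ≡ₚ x′ → y ≡ₚ y′ → x * y ≡ₚ x′ * y′
  *-congₚ {x} {x′} {y} {y′} x≡ y≡ = ≡.trans (%-distribˡ-* x y p)
    (≡.trans (≡.cong₂ (λ u v → (u * v) % p) x≡ y≡) (≡.sym (%-distribˡ-* x′ y′ p)))

  negate : ℕ → ℕ
  negate x = ℕ.pred p * x

  negate-inverseˡ : ∀ x → negate x + x ≡ₚ 0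
  negate-inverseˡ x = ∣⇒≡ₚ0 (≡.subst (p ∣_)
    (≡.trans (≡.cong (_* x) (≡.sym (ℕₚ.suc-pred p))) (ℕₚ.+-comm x (negate x)))
    (m∣m*n x))

  -- The ring ℤ/pℤ, a residue class being represented by all its members in ℕ.
  residues : CommutativeRing _ _
  residues = record
    { Carrier = ℕ
    ; _≈_ = _≡ₚ_
    ; _+_ = _+_
    ; _*_ = _*_
    ; -_ = negate
    ; 0# = 0
    ; 1# = 1
    ; isCommutativeRing = record
      { isRing = record
        { +-isAbelianGroup = record
          { isGroup = record
            { isMonoid = record
              { isSemigroup = record
                { isMagma = record
                  { isEquivalence = record
                    { refl = ≡.refl ; sym = ≡.sym ; trans = ≡.trans }
                  ; ∙-cong = λ {x} {x′} {y} {y′} → +-congₚ {x} {x′} {y} {y′}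
                  }
                ; assoc = λ x y z → ≡.cong (_% p) (ℕₚ.+-assoc x y z)
                }
              ; identity = (λ _ → ≡.refl) , λ x → ≡.cong (_% p) (ℕₚ.+-identityʳ x)
              }
            ; inverse = negate-inverseˡ , λ x →
                ≡.trans (≡.cong (_% p) (ℕₚ.+-comm x (negate x))) (negate-inverseˡ x)
            ; ⁻¹-cong = λ {x} {y} → *-congₚ {ℕ.pred p} {ℕ.pred p} {x} {y} ≡.refl
            }
          ; comm = λ x y → ≡.cong (_% p) (ℕₚ.+-comm x y)
          }
        ; *-cong = λ {x} {x′} {y} {y′} → *-congₚ {x} {x′} {y} {y′}
        ; *-assoc = λ x y z → ≡.cong (_% p) (ℕₚ.*-assoc x y z)
        ; *-identity = (λ x → ≡.cong (_% p) (ℕₚ.*-identityˡ x)) ,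
                       (λ x → ≡.cong (_% p) (ℕₚ.*-identityʳ x))
        ; distrib = (λ x y z → ≡.cong (_% p) (ℕₚ.*-distribˡ-+ x y z)) ,
                    (λ x y z → ≡.cong (_% p) (ℕₚ.*-distribʳ-+ x y z))
        }
      ; *-comm = λ x y → ≡.cong (_% p) (ℕₚ.*-comm x y)
      }
    }

  open import Algebra.Properties.Semiring.Mult (CommutativeRing.semiring residues)
    using () renaming (_×_ to _·_)

  ·≡* : ∀ m x → m · x ≡ m * x
  ·≡* zero    x = ≡.refl
  ·≡* (suc m) x = ≡.cong (x +_) (·≡* m x)

  p·x≡ₚ0 : ∀ x → p · x ≡ₚ 0
  p·x≡ₚ0 x = ≡.trans (≡.cong (_% p) (·≡* p x)) (∣⇒≡ₚ0 (m∣m*n x))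

-- Rank is at most the size of a spanning list

module RankBound {p : ℕ} (1<p : 1 < p) .{{_ : NonZero p}} where

  open import Data.Fin using (Fin; toℕ; funToFin; finToFun; combine) renaming (zero to fzero; suc to fsuc)
  open import Data.Fin.Properties
    using (pigeonhole; toℕ<n; toℕ-fromℕ<; toℕ-injective; <⇒≢;
           funToFin-finToFin; finToFun-funToFin)
  open import Data.List using (List; []; _∷_; length)
  open import Data.Nat using (_+_; _*_; _^_; _%_)
  open import Data.Nat.Divisibility using (_∣_)
  open import Data.Nat.DivMod using (_mod_; m<n⇒m%n≡m)
  open import Data.Nat.Solver using (module +-*-Solver)
  open Residues p

  ∑-congₚ : ∀ n {f g : Fin n → ℕ} → (∀ i → f i ≡ₚ g i) → ∑ n f ≡ₚ ∑ n g
  ∑-congₚ zero    eq = ≡.refl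
  ∑-congₚ (suc n) {f} {g} eq =
    +-congₚ {f fzero} {g fzero} (eq fzero) (∑-congₚ n (eq ∘ fsuc))

  ∑-+ : ∀ n (f g : Fin n → ℕ) → ∑ n (λ i → f i + g i) ≡ ∑ n f + ∑ n g
  ∑-+ zero    f g = ≡.refl
  ∑-+ (suc n) f g = ≡.trans
    (≡.cong (f fzero + g fzero +_) (∑-+ n (f ∘ fsuc) (g ∘ fsuc)))
    (solve 4 (λ a b c d → a :+ b :+ (c :+ d) := a :+ c :+ (b :+ d)) ≡.refl
      (f fzero) (g fzero) _ _)
    where open +-*-Solver

  *-∑ : ∀ n a (f : Fin n → ℕ) → a * ∑ n f ≡ ∑ n (λ i → a * f i)
  *-∑ zero    a f = ℕₚ.*-zeroʳ a
  *-∑ (suc n) a f = ≡.trans (ℕₚ.*-distribˡ-+ a _ _) (≡.cong (a * f fzero +_) (*-∑ n a (f ∘ fsuc)))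

  ∑-cong : ∀ n {f g : Fin n → ℕ} → (∀ i → f i ≡ g i) → ∑ n f ≡ ∑ n g
  ∑-cong zero    eq = ≡.refl
  ∑-cong (suc n) eq = ≡.cong₂ _+_ (eq fzero) (∑-cong n (eq ∘ fsuc))

  funToFin-cong : ∀ {m n} {f g : Fin m → Fin n} → (∀ i → f i ≡ g i) → funToFin f ≡ funToFin g
  funToFin-cong {zero}  eq = ≡.refl
  funToFin-cong {suc m} eq = ≡.cong₂ combine (eq fzero) (funToFin-cong (eq ∘ fsuc))

  module _ {J : Set} (w : ℕ) where

    open WeightedSpan residues w J
    open import Algebra.Properties.Semiring.Exp (CommutativeRing.semiring residues)
      using () renaming (_^_ to _^ₚ_)

    combination : (L : List Term) → (Fin (length L) → ℕ) → J → ℕ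
    combination []            α j = 0
    combination ((o , F) ∷ L) α j = w ^ₚ o * α fzero * F j + combination L (α ∘ fsuc) j

    Span⇒combination : ∀ {L g} → Span L g → ∃ λ α → ∀ j → g j ≡ₚ combination L α j
    Span⇒combination (nil g≈0) = (λ ()) , g≈0
    Span⇒combination (cons {o} {F} {L} {g} {h} e g≈ s) with α , eq ← Span⇒combination s =
      (λ { fzero → e ; (fsuc l) → α l }) ,
      λ j → ≡.trans (g≈ j) (+-congₚ {w ^ₚ o * e * F j} ≡.refl (eq j))

    combination-congₚ : ∀ L {α β} → (∀ l → α l ≡ₚ β l) → ∀ j →
                        combination L α j ≡ₚ combination L β j
    combination-congₚ []            eq j = ≡.refl
    combination-congₚ ((o , F) ∷ L) {α} {β} eq j = +-congₚ
      {w ^ₚ o * α fzero * F j} {w ^ₚ o * β fzero * F j}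
      (*-congₚ {w ^ₚ o * α fzero} {w ^ₚ o * β fzero}
        (*-congₚ {w ^ₚ o} {w ^ₚ o} {α fzero} {β fzero} ≡.refl (eq fzero)) ≡.refl)
      (combination-congₚ L (eq ∘ fsuc) j)

    ∑-combination : ∀ L r (c : Fin r → ℕ) (α : Fin r → Fin (length L) → ℕ) j →
                    ∑ r (λ i → c i * combination L (α i) j) ≡
                    combination L (λ l → ∑ r (λ i → c i * α i l)) j
    ∑-combination [] r c α j = zeros r c
      where
      zeros : ∀ r (c : Fin r → ℕ) → ∑ r (λ i → c i * 0) ≡ 0
      zeros zero    c = ≡.refl
      zeros (suc r) c = ≡.cong₂ _+_ (ℕₚ.*-zeroʳ (c fzero)) (zeros r (c ∘ fsuc))
    ∑-combination ((o , F) ∷ L) r c α j = begin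
      ∑ r (λ i → c i * (W * α i fzero * F j + rest i))
        ≡⟨ ∑-cong r (λ i → expand (c i) W (α i fzero) (F j) (rest i)) ⟩
      ∑ r (λ i → F j * (W * (c i * α i fzero)) + c i * rest i)
        ≡⟨ ∑-+ r _ _ ⟩
      ∑ r (λ i → F j * (W * (c i * α i fzero))) + ∑ r (λ i → c i * rest i)
        ≡⟨ ≡.cong₂ _+_
             (≡.trans (≡.sym (*-∑ r (F j) _)) (≡.cong (F j *_) (≡.sym (*-∑ r W _))))
             (∑-combination L r c (λ i → α i ∘ fsuc) j) ⟩
      F j * (W * ∑ r (λ i → c i * α i fzero)) + tail
        ≡⟨ ≡.cong (_+ tail) (ℕₚ.*-comm (F j) _) ⟩
      combination ((o , F) ∷ L) (λ l → ∑ r (λ i → c i * α i l)) j ∎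
      where
      open ≡.≡-Reasoning
      W tail : ℕ
      W = w ^ₚ o
      tail = combination L (λ l → ∑ r (λ i → c i * α i (fsuc l))) j
      rest : Fin r → ℕ
      rest i = combination L (α i ∘ fsuc) j
      expand : ∀ c W a f x → c * (W * a * f + x) ≡ f * (W * (c * a)) + c * x
      expand = solve 5 (λ c W a f x →
        c :* (W :* a :* f :+ x) := f :* (W :* (c :* a)) :+ c :* x) ≡.refl
        where open +-*-Solver

    -- With more rows than terms, two of the p ^ r combinations of the rows have
    -- the same coordinates mod p; their difference is a dependency.
    rank≤length : ∀ {I : Set} (M : I → J → ℕ) (L : List Term) → (∀ i → Span L (M i)) →
                  ∀ {r} → HasIndepRowsₚ p M r → r ≤ length L
    rank≤length M L s {r} (rows , indep) = ℕₚ.≮⇒≥ λ N<r →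
      let x , y , x<y , same = pigeonhole (ℕₚ.^-monoʳ-< p 1<p N<r) coordinates
      in <⇒≢ x<y (injective (equal same))
      where
      N = length L
      α : Fin r → Fin N → ℕ
      α i = proj₁ (Span⇒combination (s (rows i)))

      coefficient : Fin (p ^ r) → Fin r → ℕ
      coefficient x i = toℕ (finToFun {p} {r} x i)

      sums : Fin (p ^ r) → Fin N → ℕ
      sums x l = ∑ r (λ i → coefficient x i * α i l)

      coordinates : Fin (p ^ r) → Fin (p ^ N)
      coordinates x = funToFin (λ l → sums x l mod p)

      sums≡ : ∀ {x y} → coordinates x ≡ coordinates y → ∀ l → sums x l ≡ₚ sums y l
      sums≡ {x} {y} eq l = begin
        sums x l % p        ≡⟨ toℕ-fromℕ< _ ⟨
        toℕ (sums x l mod p) ≡⟨ ≡.cong toℕ (finToFun-funToFin (λ l → sums x l mod p) l) ⟨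
        toℕ (finToFun (coordinates x) l) ≡⟨ ≡.cong (λ u → toℕ (finToFun u l)) eq ⟩
        toℕ (finToFun (coordinates y) l) ≡⟨ ≡.cong toℕ (finToFun-funToFin (λ l → sums y l mod p) l) ⟩
        toℕ (sums y l mod p) ≡⟨ toℕ-fromℕ< _ ⟩
        sums y l % p        ∎
        where open ≡.≡-Reasoning

      row-sum : Fin (p ^ r) → J → ℕ
      row-sum x j = ∑ r (λ i → coefficient x i * M (rows i) j)

      row-sum≡ : ∀ x j → row-sum x j ≡ₚ combination L (sums x) j
      row-sum≡ x j = ≡.trans
        (∑-congₚ r λ i → *-congₚ {coefficient x i} ≡.refl (proj₂ (Span⇒combination (s (rows i))) j))
        (≡.cong (_% p) (∑-combination L r (coefficient x) α j))

      equal : ∀ {x y} → coordinates x ≡ coordinates y → ∀ i → coefficient x i ≡ₚ coefficient y i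
      equal {x} {y} eq i = begin
        coefficient x i
          ≈⟨ +-identityʳ _ ⟨
        coefficient x i + 0
          ≈⟨ +-congˡ {coefficient x i} (negate-inverseˡ (coefficient y i)) ⟨
        coefficient x i + (negate (coefficient y i) + coefficient y i)
          ≈⟨ +-assoc (coefficient x i) _ _ ⟨
        d i + coefficient y i
          ≈⟨ +-congʳ {coefficient y i} {d i} {0} (∣⇒≡ₚ0 (indep d dependent i)) ⟩
        coefficient y i ∎
        where
        open CommutativeRing residues using (+-identityʳ; +-congˡ; +-congʳ; +-assoc; setoid; -‿inverseʳ)
        open import Relation.Binary.Reasoning.Setoid setoid
        d : Fin r → ℕ
        d i = coefficient x i + negate (coefficient y i)
        dependent : ∀ j → p ∣ ∑ r (λ i → d i * M (rows i) j)
        dependent j = ≡ₚ0⇒∣ (begin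
          ∑ r (λ i → d i * M (rows i) j)
            ≡⟨ ∑-cong r (λ i → expand (coefficient x i) (ℕ.pred p) (coefficient y i) _) ⟩
          ∑ r (λ i → coefficient x i * M (rows i) j +
                     ℕ.pred p * (coefficient y i * M (rows i) j))
            ≡⟨ ≡.trans (∑-+ r _ _) (≡.cong (row-sum x j +_) (≡.sym (*-∑ r (ℕ.pred p) _))) ⟩
          row-sum x j + negate (row-sum y j)
            ≈⟨ +-congʳ {negate (row-sum y j)} {row-sum x j} {row-sum y j}
                 (≡.trans (row-sum≡ x j)
                   (≡.trans (combination-congₚ L (sums≡ eq) j) (≡.sym (row-sum≡ y j)))) ⟩
          row-sum y j + negate (row-sum y j)
            ≈⟨ -‿inverseʳ (row-sum y j) ⟩
          0 ∎)
          where
          expand : ∀ a q b m → (a + q * b) * m ≡ a * m + q * (b * m)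
          expand = solve 4 (λ a q b m → (a :+ q :* b) :* m := a :* m :+ q :* (b :* m)) ≡.refl
            where open +-*-Solver

      injective : ∀ {x y} → (∀ i → coefficient x i ≡ₚ coefficient y i) → x ≡ y
      injective {x} {y} eq = begin
        x                              ≡⟨ funToFin-finToFin {r} {p} x ⟨
        funToFin (finToFun {p} {r} x)  ≡⟨ funToFin-cong (λ i → toℕ-injective (begin
          coefficient x i     ≡⟨ m<n⇒m%n≡m (toℕ<n _) ⟨
          coefficient x i % p ≡⟨ eq i ⟩
          coefficient y i % p ≡⟨ m<n⇒m%n≡m (toℕ<n _) ⟩
          coefficient y i     ∎)) ⟩
        funToFin (finToFun {p} {r} y)  ≡⟨ funToFin-finToFin {r} {p} y ⟩
        y                              ∎
        where open ≡.≡-Reasoning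

-- Inequalities between `q` and the window weights

module Numerics (d : ℕ) (1≤d : 1 ≤ d) where

  open import Data.Nat using (_+_; _*_; _^_)
  open import Data.Nat.Solver using (module +-*-Solver)
  open +-*-Solver

  p : ℕ
  p = suc d

  open WindowWeights p

  -- This is `slope-≥` with `s * d` added to both sides and the relation between `k` and `s`
  -- inserted.
  power-≥ : ∀ s → (2 * s + 1) * d + s ≤ p ^ suc s
  power-≥ s = go s d 1≤d
    where
    open ℕₚ.≤-Reasoning
    go : ∀ s d → 1 ≤ d → (2 * s + 1) * d + s ≤ suc d ^ suc s
    go zero d _ = begin
      1 * d + 0  ≡⟨ solve 1 (λ d → con 1 :* d :+ con 0 := d) ≡.refl d ⟩
      d          ≤⟨ ℕₚ.n≤1+n d ⟩
      suc d      ≡⟨ ℕₚ.*-identityʳ (suc d) ⟨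
      suc d ^ 1  ∎
    -- A separate base case: multiplying the bound `d` for `s = 0` by `p` falls short of `3 * d + 1`
    -- when `d` is 1 or 2.
    go (suc zero) (suc e) _ = begin
      3 * suc e + 1
        ≤⟨ ℕₚ.m≤m+n _ (e * e + e) ⟩
      3 * suc e + 1 + (e * e + e)
        ≡⟨ solve 1 (λ e → con 3 :* (con 1 :+ e) :+ con 1 :+ (e :* e :+ e) :=
                         (con 2 :+ e) :* ((con 2 :+ e) :* con 1)) ≡.refl e ⟩
      suc (suc e) ^ 2 ∎
    go (suc (suc t)) (suc e) 1≤d = begin
      (2 * (2 + t) + 1) * suc e + (2 + t)
        ≤⟨ ℕₚ.m≤m+n _ ((2 * t + 3) * (e * e) + (5 * t + 5) * e + 3 * t + 1) ⟩
      (2 * (2 + t) + 1) * suc e + (2 + t) + ((2 * t + 3) * (e * e) + (5 * t + 5) * e + 3 * t + 1)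
        ≡⟨ solve 2 (λ t e →
             (con 2 :* (con 2 :+ t) :+ con 1) :* (con 1 :+ e) :+ (con 2 :+ t) :+
             ((con 2 :* t :+ con 3) :* (e :* e) :+ (con 5 :* t :+ con 5) :* e :+ con 3 :* t :+ con 1) :=
             (con 2 :+ e) :* ((con 2 :* (con 1 :+ t) :+ con 1) :* (con 1 :+ e) :+ (con 1 :+ t)))
             ≡.refl t e ⟩
      suc (suc e) * ((2 * suc t + 1) * suc e + suc t)
        ≤⟨ ℕₚ.*-monoʳ-≤ (suc (suc e)) (go (suc t) (suc e) 1≤d) ⟩
      suc (suc e) ^ suc (suc (suc t)) ∎

  -- Solving the recursion `O-suc` gives `O j = p ^ j + j * d * p ^ (j - 1)`; the extra factor `p`
  -- keeps `j = 0` free of division.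
  p*O : ∀ j → p * O j ≡ p ^ j * (p + j * d)
  p*O zero    = solve 1 (λ d → (con 1 :+ d) :* con 1 :=
                              con 1 :* (con 1 :+ d :+ con 0 :* d)) ≡.refl d
  p*O (suc j) = ℕₚ.+-cancelʳ-≡ (p * p ^ j) _ _ (begin
    p * O (suc j) + p * p ^ j
      ≡⟨ ℕₚ.*-distribˡ-+ p (O (suc j)) (p ^ j) ⟨
    p * (O (suc j) + p ^ j)
      ≡⟨ ≡.cong (p *_) (≡.trans (O-suc j) (≡.cong (_+ p * p ^ j) (p*O j))) ⟩
    p * (p ^ j * (p + j * d) + p * p ^ j)
      ≡⟨ solve 3 (λ d P j → (con 1 :+ d) :* (P :* (con 1 :+ d :+ j :* d) :+ (con 1 :+ d) :* P) :=
           ((con 1 :+ d) :* P) :* (con 1 :+ d :+ (con 1 :+ j) :* d) :+ (con 1 :+ d) :* P)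
           ≡.refl d (p ^ j) j ⟩
    p ^ suc j * (p + suc j * d) + p * p ^ j ∎)
    where open ≡.≡-Reasoning

  O-suc′ : ∀ j → O (suc j) ≡ p * O j + d * p ^ j
  O-suc′ j = ℕₚ.+-cancelʳ-≡ (p ^ j) _ _ (≡.trans (O-suc j)
    (solve 3 (λ d o P → (con 1 :+ d) :* o :+ (con 1 :+ d) :* P :=
                       (con 1 :+ d) :* o :+ d :* P :+ P) ≡.refl d (O j) (p ^ j)))

  module _ (m s : ℕ) (geometric : (m + suc s) * d + 1 ≡ p ^ suc s) where

    private
      q : ℕ
      q = p ^ (m + suc s)

    -- The hypothesis on `k`, regrouped to compare `q = p ^ m * p ^ suc s` with
    -- `p * O m = p ^ m * (p + m * d)`.
    slope : p + m * d + s * d ≡ p ^ suc s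
    slope = ≡.trans (solve 3 (λ d m s → con 1 :+ d :+ m :* d :+ s :* d :=
      (m :+ (con 1 :+ s)) :* d :+ con 1) ≡.refl d m s) geometric

    -- The summand `d` beyond `s * d + s` pays for `divisible-U+V`, where the window level is one
    -- lower.
    slope-≥ : (s + 1) * d + s ≤ p + m * d
    slope-≥ = ℕₚ.+-cancelʳ-≤ (s * d) _ _ (begin
      (s + 1) * d + s + s * d
        ≡⟨ solve 2 (λ d s → (s :+ con 1) :* d :+ s :+ s :* d :=
                           (con 2 :* s :+ con 1) :* d :+ s) ≡.refl d s ⟩
      (2 * s + 1) * d + s ≤⟨ power-≥ s ⟩
      p ^ suc s           ≡⟨ slope ⟨
      p + m * d + s * d   ∎)
      where open ℕₚ.≤-Reasoning

    q≡ : q ≡ p * O m + p ^ m * (s * d)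
    q≡ = begin
      p ^ (m + suc s)                     ≡⟨ ℕₚ.^-distribˡ-+-* p m (suc s) ⟩
      p ^ m * p ^ suc s                   ≡⟨ ≡.cong (p ^ m *_) slope ⟨
      p ^ m * (p + m * d + s * d)         ≡⟨ ℕₚ.*-distribˡ-+ (p ^ m) (p + m * d) (s * d) ⟩
      p ^ m * (p + m * d) + p ^ m * (s * d) ≡⟨ ≡.cong (_+ p ^ m * (s * d)) (p*O m) ⟨
      p * O m + p ^ m * (s * d)           ∎
      where open ≡.≡-Reasoning

    -- Makes all terms after the second window free: directly for exponent `e = p`, and through
    -- `pO≤O-suc` for `e = 1`.
    q≤2pO : q ≤ 2 * (p * O m)
    q≤2pO = begin
      q                           ≡⟨ q≡ ⟩
      p * O m + p ^ m * (s * d)   ≤⟨ ℕₚ.+-monoʳ-≤ (p * O m) (ℕₚ.*-monoʳ-≤ (p ^ m) sd≤) ⟩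
      p * O m + p ^ m * (p + m * d) ≡⟨ ≡.cong (p * O m +_) (p*O m) ⟨
      p * O m + p * O m           ≡⟨ ≡.cong (p * O m +_) (ℕₚ.+-identityʳ _) ⟨
      2 * (p * O m)               ∎
      where
      open ℕₚ.≤-Reasoning
      sd≤ : s * d ≤ p + m * d
      sd≤ = begin
        s * d           ≤⟨ ℕₚ.*-monoˡ-≤ d (ℕₚ.m≤m+n s 1) ⟩
        (s + 1) * d     ≤⟨ ℕₚ.m≤m+n _ s ⟩
        (s + 1) * d + s ≤⟨ slope-≥ ⟩
        p + m * d       ∎

    pO≤O-suc : p * O m ≤ O (suc m)
    pO≤O-suc = ℕₚ.≤-trans (ℕₚ.m≤m+n _ (d * p ^ m)) (ℕₚ.≤-reflexive (≡.sym (O-suc′ m)))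

    general-2U : q ≤ 2 * (1 * O (suc m))
    general-2U = ℕₚ.≤-trans q≤2pO (ℕₚ.*-monoʳ-≤ 2
      (ℕₚ.≤-trans pO≤O-suc (ℕₚ.≤-reflexive (≡.sym (ℕₚ.*-identityˡ _)))))

    general-U+V : q ≤ 1 * O (suc m) + d * (1 * O m)
    general-U+V = begin
      q
        ≡⟨ q≡ ⟩
      p * O m + p ^ m * (s * d)
        ≡⟨ ≡.cong (p * O m +_) (solve 3 (λ P s d → P :* (s :* d) := d :* (P :* s)) ≡.refl (p ^ m) s d) ⟩
      p * O m + d * (p ^ m * s)
        ≤⟨ ℕₚ.+-mono-≤ pO≤O-suc (ℕₚ.*-monoʳ-≤ d (ℕₚ.*-cancelˡ-≤ p Ps≤)) ⟩
      O (suc m) + d * O m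
        ≡⟨ ≡.cong₂ (λ u v → u + d * v) (ℕₚ.*-identityˡ _) (ℕₚ.*-identityˡ _) ⟨
      1 * O (suc m) + d * (1 * O m) ∎
      where
      open ℕₚ.≤-Reasoning
      Ps≤ : p * (p ^ m * s) ≤ p * O m
      Ps≤ = begin
        p * (p ^ m * s)
          ≡⟨ solve 3 (λ d P s → (con 1 :+ d) :* (P :* s) := P :* (s :* d :+ s)) ≡.refl d (p ^ m) s ⟩
        p ^ m * (s * d + s)
          ≤⟨ ℕₚ.*-monoʳ-≤ (p ^ m) (ℕₚ.≤-trans
               (ℕₚ.+-monoˡ-≤ s (ℕₚ.*-monoˡ-≤ d (ℕₚ.m≤m+n s 1))) slope-≥) ⟩
        p ^ m * (p + m * d)
          ≡⟨ p*O m ⟨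
        p * O m ∎

  divisible-U+V : ∀ m s → (suc m + suc s) * d + 1 ≡ p ^ suc s →
                  p ^ (suc m + suc s) ≤ p * O (suc m) + d * (p * O m)
  divisible-U+V m s geometric = begin
    p ^ (suc m + suc s)
      ≡⟨ q≡ (suc m) s geometric ⟩
    p * O (suc m) + p ^ suc m * (s * d)
      ≡⟨ ≡.cong (p * O (suc m) +_) (solve 3 (λ d P s →
           (con 1 :+ d) :* P :* (s :* d) := d :* (P :* (s :* d :+ s))) ≡.refl d (p ^ m) s) ⟩
    p * O (suc m) + d * (p ^ m * (s * d + s))
      ≤⟨ ℕₚ.+-monoʳ-≤ (p * O (suc m)) (ℕₚ.*-monoʳ-≤ d (ℕₚ.*-monoʳ-≤ (p ^ m) sp≤)) ⟩
    p * O (suc m) + d * (p ^ m * (p + m * d))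
      ≡⟨ ≡.cong (λ u → p * O (suc m) + d * u) (p*O m) ⟨
    p * O (suc m) + d * (p * O m) ∎
    where
    open ℕₚ.≤-Reasoning
    sp≤ : s * d + s ≤ p + m * d
    sp≤ = ℕₚ.+-cancelʳ-≤ d _ _ (begin
      s * d + s + d   ≡⟨ solve 2 (λ s d → s :* d :+ s :+ d := (s :+ con 1) :* d :+ s) ≡.refl s d ⟩
      (s + 1) * d + s ≤⟨ slope-≥ (suc m) s geometric ⟩
      p + suc m * d   ≡⟨ solve 3 (λ p m d → p :+ (con 1 :+ m) :* d := p :+ m :* d :+ d) ≡.refl p m d ⟩
      p + m * d + d   ∎)

  -- For `m = 0` the geometric sum of `s + 1` powers of `p` equals its number of terms, so only the
  -- term `1` can occur.
  s≡0 : ∀ s → suc s * d + 1 ≡ p ^ suc s → s ≡ 0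
  s≡0 zero    _         = ≡.refl
  s≡0 (suc s) geometric = contradiction (slope-≥ 0 (suc s) geometric) (ℕₚ.<⇒≱ (begin-strict
    p + 0 * d                     ≡⟨ solve 1 (λ d → con 1 :+ d :+ con 0 :* d := con 1 :+ d) ≡.refl d ⟩
    1 + d                         <⟨ ℕₚ.m<m+n (1 + d) (ℕₚ.≤-trans 1≤d (ℕₚ.m≤m+n d _)) ⟩
    1 + d + (d + (s * d + s))     ≡⟨ solve 2 (λ s d → con 1 :+ d :+ (d :+ (s :* d :+ s)) :=
                                       (con 1 :+ s :+ con 1) :* d :+ (con 1 :+ s)) ≡.refl s d ⟩
    (suc s + 1) * d + suc s       ∎))
    where open ℕₚ.≤-Reasoning

  1+s≤k : ∀ {k} s → k * d + 1 ≡ p ^ suc s → suc s ≤ k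
  1+s≤k {k} s eq = ℕₚ.*-cancelʳ-≤ (suc s) k d {{ℕ.>-nonZero 1≤d}}
    (ℕₚ.+-cancelʳ-≤ 1 _ _ (begin
      suc s * d + 1        ≤⟨ bound s ⟩
      p ^ suc s            ≡⟨ eq ⟨
      k * d + 1            ∎))
    where
    open ℕₚ.≤-Reasoning
    bound : ∀ s → suc s * d + 1 ≤ p ^ suc s
    bound zero    = ℕₚ.≤-reflexive (solve 1 (λ d → con 1 :* d :+ con 1 := (con 1 :+ d) :* con 1) ≡.refl d)
    bound (suc s) = begin
      suc (suc s) * d + 1        ≤⟨ ℕₚ.m≤m+n _ (d * (suc s * d)) ⟩
      suc (suc s) * d + 1 + d * (suc s * d)
        ≡⟨ solve 2 (λ s d → (con 2 :+ s) :* d :+ con 1 :+ d :* ((con 1 :+ s) :* d) :=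
                           (con 1 :+ d) :* ((con 1 :+ s) :* d :+ con 1)) ≡.refl s d ⟩
      p * (suc s * d + 1)        ≤⟨ ℕₚ.*-monoʳ-≤ p (bound s) ⟩
      p ^ suc (suc s)            ∎

-- One list of terms for all rows

module Rows {c ℓ} (R : CommutativeRing c ℓ) (w : CommutativeRing.Carrier R) where

  open CommutativeRing R
  open import Algebra.Properties.Semiring.Exp semiring
    using (_^_; ^-congˡ; ^-homo-*; ^-assocʳ)
  open import Algebra.Properties.Semiring.Mult semiring using () renaming (_×_ to _·_)
  open import Data.Fin using (Fin; toℕ) renaming (zero to fzero; suc to fsuc)
  open import Data.Fin.Properties using (toℕ<n)
  open import Data.List using (List; []; _∷_)
  open import Data.Nat.Divisibility using (divides) renaming (_∣_ to _∣ₙ_)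
  open import Data.Nat.Primality using (Prime)
  open Frobenius R using (frobenius)
  open import Relation.Binary.Reasoning.Setoid setoid
  open Coordinate R using (coordinate; Span-coordinate; Cost≤-coordinate)

  z : Carrier
  z = 1# + w

  private
    1^n≈1 : ∀ n → 1# ^ n ≈ 1#
    1^n≈1 zero    = refl
    1^n≈1 (suc n) = trans (*-identityˡ _) (1^n≈1 n)

  module _ (d : ℕ) (1≤d : 1 ≤ d) where

    open Numerics d 1≤d

    module _ (pp : Prime p) (char : ∀ x → p · x ≈ 0#) (m s n : ℕ)
             (geometric : (m ℕ.+ suc s) ℕ.* d ℕ.+ 1 ≡ p ℕ.^ suc s) where

      private
        q : ℕ
        q = p ℕ.^ (m ℕ.+ suc s)
        J : Set
        J = Rⁿ q n

      open WeightedSpan R w J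

      private
        v : Fin n → J → ℕ
        v i x = toℕ (x i)

        -- Interpolation needs more nodes than any coordinate value. The crude count of `2 + q`
        -- blocks is harmless, since blocks after the second cost nothing.
        length-≥ : ∀ j i x → v i x < (2 ℕ.+ q) ℕ.* p ℕ.^ j
        length-≥ j i x = ℕₚ.<-≤-trans (toℕ<n (x i)) (ℕₚ.≤-trans
          (ℕₚ.m≤n+m q 2) (ℕₚ.m≤m*n (2 ℕ.+ q) (p ℕ.^ j) {{ℕₚ.m^n≢0 p j}}))

        z≈ : 1# + w ^ 1 ≈ z
        z≈ = +-congˡ (*-identityʳ w)

        general : Fin n → List Term
        general i = coordinate pp char w J 1 m ((2 ℕ.+ q) ℕ.* p ℕ.^ suc m) (v i)

        general-span : ∀ b i → Span (general i) (λ x → (z ^ b) ^ v i x)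
        general-span b i = Span-cong
          (λ x → ^-congˡ (v i x) (^-congˡ b z≈))
          (Span-coordinate pp char w J 1 m _ (length-≥ (suc m) i) b)

        general-cost : ∀ i → Cost≤ q (p ℕ.^ suc m) (general i)
        general-cost i = Cost≤-coordinate pp char w J 1 m q
          (general-U+V m s geometric) (general-2U m s geometric)

        -- The list and its properties are produced together because the construction splits on `m`:
        -- interpolating in `b / p` uses windows of length `p ^ m`, and `coordinate` asks for that
        -- level to be a successor.
        divisible : ∃ λ (P : Fin n → List Term) →
          (∀ b i → p ∣ₙ b → b < q → Span (P i) (λ x → (z ^ b) ^ v i x)) ×
          (∀ i → Cost≤ q (p ℕ.^ m) (P i))
        divisible = go m geometric
          where
          go : ∀ m → (m ℕ.+ suc s) ℕ.* d ℕ.+ 1 ≡ p ℕ.^ suc s →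
               ∃ λ (P : Fin n → List Term) →
               (∀ b i → p ∣ₙ b → b < p ℕ.^ (m ℕ.+ suc s) → Span (P i) (λ x → (z ^ b) ^ v i x)) ×
               (∀ i → Cost≤ (p ℕ.^ (m ℕ.+ suc s)) (p ℕ.^ m) (P i))
          go zero geometric = (λ i → (0 , λ x → 1#) ∷ []) ,
            (λ b i p∣b b<q → Span-cong (λ x → sym (power-1 b (v i x) p∣b b<q)) (Span-unit _)) ,
            (λ i → Cost≤-unit _)
            where
            -- Here s = 0, so b is a multiple of p below p.
            b≡0 : ∀ b → p ∣ₙ b → b < p ℕ.^ suc s → b ≡ 0
            b≡0 b (divides zero    eq) b<q = eq
            b≡0 b (divides (suc a) eq) b<q = contradiction b<q (ℕₚ.≤⇒≯
              (≡.subst (λ s → p ℕ.^ suc s ≤ b) (≡.sym (s≡0 s geometric))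
                (≡.subst₂ _≤_ (≡.sym (ℕₚ.*-identityʳ p)) (≡.sym eq) (ℕₚ.m≤m+n p (a ℕ.* p)))))
            power-1 : ∀ b n → p ∣ₙ b → b < p ℕ.^ suc s → (z ^ b) ^ n ≈ 1#
            power-1 b n p∣b b<q rewrite b≡0 b p∣b b<q = 1^n≈1 n
          -- For `b = a * p`, Frobenius gives `z ^ b = (1 + w ^ p) ^ a`. Interpolating in `a` lowers
          -- the window level by one and multiplies every order by `p`.
          go (suc m) geometric =
            (λ i → coordinate pp char w J p m ((2 ℕ.+ q) ℕ.* p ℕ.^ suc m) (v i)) ,
            (λ { b i (divides a ≡.refl) b<q → Span-cong
                 (λ x → ^-congˡ (v i x) (z^[p]^a a))
                 (Span-coordinate pp char w J p m _ (length-≥ (suc m) i) a) }) ,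
            (λ i → Cost≤-coordinate pp char w J p m q
              (divisible-U+V m s geometric) (q≤2pO (suc m) s geometric))
            where
            z^[p]^a : ∀ a → (1# + w ^ p) ^ a ≈ z ^ (a ℕ.* p)
            z^[p]^a a = begin
              (1# + w ^ p) ^ a
                ≈⟨ ^-congˡ a (trans (frobenius pp char 1# w) (+-congʳ (1^n≈1 p))) ⟨
              (z ^ p) ^ a      ≈⟨ ^-assocʳ z p a ⟩
              z ^ (p ℕ.* a)    ≡⟨ ≡.cong (z ^_) (ℕₚ.*-comm p a) ⟩
              z ^ (a ℕ.* p)    ∎

        ∏-power : ∀ n (b v : Fin n → ℕ) →
                  ∏ n (λ i → (z ^ b i) ^ v i) ≈ z ^ ∑ n (λ i → b i ℕ.* v i)
        ∏-power zero    b v = refl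
        ∏-power (suc n) b v = trans
          (*-cong (^-assocʳ z (b fzero) (v fzero)) (∏-power n (b ∘ fsuc) (v ∘ fsuc)))
          (sym (^-homo-* z (b fzero ℕ.* v fzero) _))

      rowTerms : List Term
      rowTerms = charts n (proj₁ divisible) general (λ i x → z ^ v i x)

      Span-row : ((b , _) : ProjSpace p (m ℕ.+ suc s) n) → Span rowTerms (λ x → z ^ dotℕ b x)
      Span-row (b , i₀ , before , b[i₀]≡1) = Span-cong
        (λ x → ∏-power n (toℕ ∘ b) (λ i → v i x))
        (Span-charts n i₀
          (λ i i<i₀ → proj₁ (proj₂ divisible) (toℕ (b i)) i (before i i<i₀) (toℕ<n (b i)))
          (λ x → ^-congˡ (v i₀ x)
            (trans (reflexive (≡.cong (z ^_) b[i₀]≡1)) (*-identityʳ z)))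
          (λ i → general-span (toℕ (b i)) i))

      cost-rowTerms : cost rowTerms q ≤ chartBound (p ℕ.^ suc m) (p ℕ.^ m) n ℕ.* q
      cost-rowTerms = Cost≤-charts n _ _ _ (proj₂ (proj₂ divisible)) general-cost
        .Cost≤.bound ℕₚ.≤-refl

-- From the geometric sum to the stated bound

module _ where

  open import Data.Nat using (_+_; _*_; _^_)
  open import Data.Nat.Solver using (module +-*-Solver)
  open +-*-Solver

  -- The identity `(C - D) * B + D ^ n = C ^ n` for the geometric sum `B`, with `C - D = a * d`.
  chartBound-geometric : ∀ d a n →
    a * (d * chartBound (suc d * a) a n) + a ^ n ≡ (suc d * a) ^ n
  chartBound-geometric d a zero    =
    solve 2 (λ d a → a :* (d :* con 0) :+ con 1 := con 1) ≡.refl d a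
  chartBound-geometric d a (suc n) = begin
    a * (d * (E + a * B)) + a * a ^ n
      ≡⟨ solve 5 (λ d a E B A → a :* (d :* (E :+ a :* B)) :+ a :* A :=
           a :* d :* E :+ a :* (a :* (d :* B) :+ A)) ≡.refl d a E B (a ^ n) ⟩
    a * d * E + a * (a * (d * B) + a ^ n)
      ≡⟨ ≡.cong (λ u → a * d * E + a * u) (chartBound-geometric d a n) ⟩
    a * d * E + a * E
      ≡⟨ solve 3 (λ d a E → a :* d :* E :+ a :* E := (con 1 :+ d) :* a :* E) ≡.refl d a E ⟩
    (suc d * a) ^ suc n ∎
    where
    open ≡.≡-Reasoning
    E B : ℕ
    E = (suc d * a) ^ n
    B = chartBound (suc d * a) a n

  -- The dimension is `suc n`. One factor `d` sums the geometric series, the other `n` combine with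
  -- `k ^ n` into `(k * d) ^ n ≤ b ^ n`; with `p ^ k = a * b` everything collects into
  -- `(p * a * b) ^ suc n`.
  rank-arithmetic : ∀ {d k m s r} n → k ≡ m + suc s → k * d ≤ suc d ^ suc s →
    r ≤ chartBound (suc d ^ suc m) (suc d ^ m) (suc n) * suc d ^ k →
    r * k ^ n * d ^ suc n ≤ suc d ^ (k * suc n + suc n)
  rank-arithmetic {d} {k} {m} {s} {r} n k≡ kd≤ r≤ = begin
    r * k ^ n * d ^ suc n
      ≡⟨ solve 4 (λ r K d D → r :* K :* (d :* D) := r :* d :* (K :* D)) ≡.refl r (k ^ n) d (d ^ n) ⟩
    r * d * (k ^ n * d ^ n)
      ≡⟨ ≡.cong (r * d *_) (^-distribʳ-* k d n) ⟨
    r * d * (k * d) ^ n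
      ≤⟨ ℕₚ.*-mono-≤ (ℕₚ.*-monoˡ-≤ d r≤) (ℕₚ.^-monoˡ-≤ n kd≤) ⟩
    B * p ^ k * d * b ^ n
      ≡⟨ ≡.cong (λ u → B * u * d * b ^ n) q≡ab ⟩
    B * (a * b) * d * b ^ n
      ≡⟨ solve 5 (λ B a b d E → B :* (a :* b) :* d :* E := a :* (d :* B) :* (b :* E))
           ≡.refl B a b d (b ^ n) ⟩
    a * (d * B) * b ^ suc n
      ≤⟨ ℕₚ.*-monoˡ-≤ (b ^ suc n) (ℕₚ.≤-trans (ℕₚ.m≤m+n _ (a ^ suc n))
           (ℕₚ.≤-reflexive (chartBound-geometric d a (suc n)))) ⟩
    (p * a) ^ suc n * b ^ suc n
      ≡⟨ ^-distribʳ-* (p * a) b (suc n) ⟨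
    (p * a * b) ^ suc n
      ≡⟨ ≡.cong (_^ suc n) (≡.trans (ℕₚ.*-assoc p a b) (≡.cong (p *_) (≡.sym q≡ab))) ⟩
    (p ^ suc k) ^ suc n
      ≡⟨ ℕₚ.^-*-assoc p (suc k) (suc n) ⟩
    p ^ (suc k * suc n)
      ≡⟨ ≡.cong (p ^_) (ℕₚ.+-comm (suc n) (k * suc n)) ⟩
    p ^ (k * suc n + suc n) ∎
    where
    open ℕₚ.≤-Reasoning
    p a b B : ℕ
    p = suc d
    a = p ^ m
    b = p ^ suc s
    B = chartBound (p * a) a (suc n)
    q≡ab : p ^ k ≡ a * b
    q≡ab = ≡.trans (≡.cong (p ^_) k≡) (ℕₚ.^-distribˡ-+-* p m (suc s))
    ^-distribʳ-* : ∀ x y n → (x * y) ^ n ≡ x ^ n * y ^ n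
    ^-distribʳ-* x y zero    = ≡.refl
    ^-distribʳ-* x y (suc n) = ≡.trans (≡.cong (x * y *_) (^-distribʳ-* x y n))
      (solve 4 (λ x y X Y → x :* y :* (X :* Y) := x :* X :* (y :* Y)) ≡.refl x y (x ^ n) (y ^ n))

-- Incidence rows as functionals of powers of `z`

module Incidence (d : ℕ) (1≤d : 1 ≤ d) where

  open import Data.Fin using (Fin; toℕ)
  open import Data.Nat using (_+_; _*_; _^_; _%_; _/_)
  open import Data.Nat.Divisibility using (divides)
  open import Data.Nat.DivMod using (m≡m%n+[m/n]*n; m%n<n)
  open import Data.Nat.Primality using (Prime)
  open Numerics d 1≤d using (p)
  open Residues p using (residues; p·x≡ₚ0)
  open PowerSeries residues
  open import Algebra.Properties.Semiring.Exp S.semiring using () renaming (_^_ to _^ₛ_)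
  open import Algebra.Properties.Semiring.Mult S.semiring using () renaming (_×_ to _·ₛ_)
  open CommutativeRing residues using (setoid; _≈_)

  char : ∀ f → p ·ₛ f S.≈ S.0#
  char f n = ≡.trans (series-× p f n) (p·x≡ₚ0 (f n))

  indicator : ∀ {q} → Fin q → ℕ → ℕ
  indicator λ₀ x with x ℕ.≟ toℕ λ₀
  ... | yes _ = 1
  ... | no  _ = 0

  isIncident≡indicator : ∀ q .{{_ : NonZero q}} n b (λ₀ : Fin q) v →
                         isIncident q n b λ₀ v ≡ indicator λ₀ (dotℕ b v % q)
  isIncident≡indicator q n b λ₀ v with (dotℕ b v % q) ℕ.≟ toℕ λ₀
  ... | yes _ = ≡.refl
  ... | no  _ = ≡.refl

  module _ (pp : Prime p) (m s n : ℕ)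
           (geometric : (m + suc s) * d + 1 ≡ p ^ suc s) where

    private
      k q : ℕ
      k = m + suc s
      q = p ^ k
      instance
        q≢0 : NonZero q
        q≢0 = ℕₚ.m^n≢0 p k

    open Rows series X using (rowTerms; Span-row; cost-rowTerms)
    open import Relation.Binary.Reasoning.Setoid setoid

    -- (1 + w) ^ x depends only on x mod q once w ^ q is discarded, so every
    -- function of x mod q is read off its coefficients below q.
    pair-indicator : ∀ (λ₀ : Fin q) x →
                     pair q (differences (indicator λ₀)) (z ^ₛ x) ≈ indicator λ₀ (x % q)
    pair-indicator λ₀ x = begin
      pair q f̂ (z ^ₛ x)
        ≡⟨ ≡.cong (λ y → pair q f̂ (z ^ₛ y)) (m≡m%n+[m/n]*n x q) ⟩
      pair q f̂ (z ^ₛ (x % q + x / q * q))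
        ≈⟨ pair-∣ q f̂ (z ^ₛ (x % q + x / q * q)) (z ^ₛ (x % q))
             (Coordinate.z^b-z^[b+d] series pp char X k (x % q) (divides (x / q) ≡.refl)) ⟩
      pair q f̂ (z ^ₛ (x % q))
        ≈⟨ pair-differences q (indicator λ₀) (x % q) (m%n<n x q) ⟩
      indicator λ₀ (x % q) ∎
      where
      f̂ : ℕ → ℕ
      f̂ = differences (indicator λ₀)

    rank-≤ : ∀ {r} → HasIndepRowsₚ p (A p k n pp) r →
             r ≤ chartBound (p ^ suc m) (p ^ m) n * q
    rank-≤ {r} indep = ℕₚ.≤-trans
      -- The base `0` is harmless: all terms of `coefficients` have order 0, and `0 ^ 0 = 1`.
      (RankBound.rank≤length (s≤s 1≤d) 0 (A p k n pp) (coefficients J q T) span indep)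
      (ℕₚ.≤-trans (ℕₚ.≤-reflexive (length-coefficients J q T))
                  (cost-rowTerms d 1≤d pp char m s n geometric))
      where
      J = Rⁿ q n
      T = rowTerms d 1≤d pp char m s n geometric
      span : ∀ row → L.Span J (coefficients J q T) (A p k n pp row)
      span ((b , rep) , λ₀) = L.Span-cong J
        (λ v → ≡.trans (pair-indicator λ₀ (dotℕ b v))
          (≡.cong (_% p) (≡.sym (isIncident≡indicator q n b λ₀ v))))
        (Span-coefficients J q (differences (indicator λ₀))
          (Span-row d 1≤d pp char m s n geometric (b , rep)))

open import Data.Nat using (_+_; _*_; _^_)
open import Data.Nat.Primality using (Prime; ¬prime[0]; ¬prime[1])

theorem2 : (p k n s : ℕ) → (pp : Prime p) → 1 ≤ k → 1 ≤ n →
    k * (p ∸ 1) ≡ p ^ suc s ∸ 1 →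
    (r : ℕ) → HasIndepRowsₚ p (A p k n pp) r →
    r * k ^ (n ∸ 1) * (p ∸ 1) ^ n ≤ p ^ (k * n + n)
theorem2 zero          k n s pp = contradiction pp ¬prime[0]
theorem2 (suc zero)    k n s pp = contradiction pp ¬prime[1]
theorem2 p@(suc d@(suc _)) k (suc n) s pp 1≤k 1≤n kd≡ r indep =
  rank-arithmetic n k≡ (ℕₚ.≤-trans (ℕₚ.m≤m+n _ 1) (ℕₚ.≤-reflexive geometric))
    (≡.subst (λ k → r ≤ chartBound (p ^ suc m) (p ^ m) (suc n) * p ^ k) (≡.sym k≡)
      (Incidence.rank-≤ d (s≤s z≤n) pp m s (suc n)
        (≡.subst (λ k → k * d + 1 ≡ p ^ suc s) k≡ geometric)
        (≡.subst (λ k → HasIndepRowsₚ p (A p k (suc n) pp) r) k≡ indep)))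
  where
  geometric : k * d + 1 ≡ p ^ suc s
  geometric = ≡.trans (≡.cong (_+ 1) kd≡) (ℕₚ.m∸n+n≡m (ℕₚ.m^n>0 p (suc s)))
  m : ℕ
  m = k ∸ suc s
  k≡ : k ≡ m + suc s
  k≡ = ≡.sym (ℕₚ.m∸n+n≡m (Numerics.1+s≤k d (s≤s z≤n) s geometric))
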